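{- The Baer-Specker group $\mathbb{Z}^\omega$ is never the union of a chain of proper subgroups with cotorsionfree quotients. That is, for every ordinal $\delta$ and every ascending chain $\langle A_\alpha : \alpha < \delta \rangle$ (so $A_\alpha \subseteq A_\beta$ whenever $\alpha \le \beta < \delta$; the chain is not assumed continuous) of proper subgroups of $\mathbb{Z}^\omega$ such that $\mathbb{Z}^\omega/A_\alpha$ is cotorsionfree for every $\alpha < \delta$, one has $\mathbb{Z}^\omega \neq \bigcup_{\alpha<\delta} A_\alpha$.
   Context: All groups are abelian. $\mathbb{Z}^\omega$ is the direct product of countably many copies of $\mathbb{Z}$. A group $G$ is cotorsion if $\mathrm{Ext}(J,G)=0$ for every torsionfree group $J$ (equivalently $\mathrm{Ext}(\mathbb{Q},G)=0$). A group is cotorsionfree if it has no nonzero cotorsion subgroup; equivalently, it contains no subgroup isomorphic to $\mathbb{Q}$, to $\mathbb{Z}/p\mathbb{Z}$, or to the group $J_p$ of $p$-adic integers, for any prime $p$. -}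

module Defs where

open import Level using (Level; _⊔_; suc; 0ℓ)
open import Algebra.Bundles using (AbelianGroup; RawGroup)
import Algebra.Construct.DirectProduct as DirectProduct
import Algebra.Construct.Pointwise as Pointwise
import Algebra.Definitions.RawMonoid as RawMonoidDefinitions
import Algebra.Morphism.GroupMonomorphism as GroupMonomorphism
open import Algebra.Morphism.Structures
  using (IsGroupHomomorphism; IsGroupMonomorphism; IsGroupIsomorphism)
import Algebra.Properties.AbelianGroup as AbelianGroupProperties
import Data.Integer.Properties as ℤ
open import Data.Nat.Base using (ℕ; NonZero)
open import Data.Product.Base using (Σ; Σ-syntax; ∃-syntax; _×_; _,_; proj₁; proj₂)
open import Function.Base using (id)
open import Function.Bundles using (_⇔_)
open import Function.Definitions using (Surjective)
open import Induction.WellFounded using (WellFounded)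
open import Relation.Binary.Bundles using (StrictTotalOrder)
import Relation.Binary.Construct.StrictToNonStrict as StrictToNonStrict
import Relation.Binary.PropositionalEquality.Core as ≡
import Relation.Binary.Reasoning.Setoid as SetoidReasoning
open import Relation.Nullary.Negation.Core using (¬_)
open import Relation.Unary using (Pred; _∈_; _⊆_; Universal)

private
  variable
    c ℓ ℓ₁ ℓ₂ ℓ₃ p : Level

------------------------------------------------------------------------
-- Subgroups and quotients

record Subgroup (G : AbelianGroup c ℓ) (p : Level) : Set (c ⊔ ℓ ⊔ suc p) where
  open AbelianGroup G
  field
    member    : Pred Carrier p
    resp      : ∀ {x y} → x ≈ y → x ∈ member → y ∈ member
    ε-closed  : ε ∈ member
    ∙-closed  : ∀ {x y} → x ∈ member → y ∈ member → (x ∙ y) ∈ member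
    ⁻¹-closed : ∀ {x} → x ∈ member → (x ⁻¹) ∈ member

module _ {G : AbelianGroup c ℓ} where
  open AbelianGroup G

  infix 4 _≤ₛ_

  _≤ₛ_ : Subgroup G p → Subgroup G p → Set _
  A ≤ₛ B = Subgroup.member A ⊆ Subgroup.member B

  Proper : Subgroup G p → Set _
  Proper A = ¬ Universal (Subgroup.member A)

  Trivial : Subgroup G p → Set _
  Trivial A = ∀ {x} → x ∈ Subgroup.member A → x ≈ ε

module _ (G : AbelianGroup c ℓ) (H : Subgroup G p) where
  open AbelianGroup G
  open Subgroup H

  subgroupRawGroup : RawGroup (c ⊔ p) ℓ
  subgroupRawGroup = record
    { Carrier = Σ Carrier member
    ; _≈_     = λ x y → proj₁ x ≈ proj₁ y
    ; _∙_     = λ x y → proj₁ x ∙ proj₁ y , ∙-closed (proj₂ x) (proj₂ y)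
    ; ε       = ε , ε-closed
    ; _⁻¹     = λ x → proj₁ x ⁻¹ , ⁻¹-closed (proj₂ x)
    }

  inclusion-isGroupMonomorphism : IsGroupMonomorphism subgroupRawGroup rawGroup proj₁
  inclusion-isGroupMonomorphism = record
    { isGroupHomomorphism = record
      { isMonoidHomomorphism = record
        { isMagmaHomomorphism = record
          { isRelHomomorphism = record { cong = id }
          ; homo = λ _ _ → refl
          }
        ; ε-homo = refl
        }
      ; ⁻¹-homo = λ _ → refl
      }
    ; injective = id
    }

  subgroup : AbelianGroup (c ⊔ p) ℓ
  subgroup = record
    { isAbelianGroup =
        GroupMonomorphism.isAbelianGroup inclusion-isGroupMonomorphism isAbelianGroup
    }

-- G / A keeps the carrier and operations of G; its equality is congruence
-- modulo A.

module _ (G : AbelianGroup c ℓ) (A : Subgroup G p) where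
  open AbelianGroup G
  open Subgroup A
  open AbelianGroupProperties G using (⁻¹-anti-homo‿-; ⁻¹-∙-comm; x≈y⇒x∙y⁻¹≈ε)
  open SetoidReasoning setoid

  private
    infix 4 _∼_

    _∼_ : Carrier → Carrier → Set p
    x ∼ y = (x - y) ∈ member

    ≈⇒∼ : ∀ {x y} → x ≈ y → x ∼ y
    ≈⇒∼ x≈y = resp (sym (x≈y⇒x∙y⁻¹≈ε x≈y)) ε-closed

    ∼-sym : ∀ {x y} → x ∼ y → y ∼ x
    ∼-sym {x} {y} x∼y = resp (⁻¹-anti-homo‿- x y) (⁻¹-closed x∼y)

    interchange : ∀ w x y z → (w ∙ x) ∙ (y ∙ z) ≈ (w ∙ y) ∙ (x ∙ z)
    interchange w x y z = begin
      (w ∙ x) ∙ (y ∙ z)  ≈⟨ assoc w x (y ∙ z) ⟩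
      w ∙ (x ∙ (y ∙ z))  ≈⟨ ∙-congˡ (assoc x y z) ⟨
      w ∙ ((x ∙ y) ∙ z)  ≈⟨ ∙-congˡ (∙-congʳ (comm x y)) ⟩
      w ∙ ((y ∙ x) ∙ z)  ≈⟨ ∙-congˡ (assoc y x z) ⟩
      w ∙ (y ∙ (x ∙ z))  ≈⟨ assoc w y (x ∙ z) ⟨
      (w ∙ y) ∙ (x ∙ z)  ∎

    telescope : ∀ x y z → (x - y) ∙ (y - z) ≈ x - z
    telescope x y z = begin
      (x - y) ∙ (y - z)        ≈⟨ assoc x (y ⁻¹) (y - z) ⟩
      x ∙ (y ⁻¹ ∙ (y ∙ z ⁻¹))  ≈⟨ ∙-congˡ (assoc (y ⁻¹) y (z ⁻¹)) ⟨
      x ∙ ((y ⁻¹ ∙ y) ∙ z ⁻¹)  ≈⟨ ∙-congˡ (∙-congʳ (inverseˡ y)) ⟩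
      x ∙ (ε ∙ z ⁻¹)           ≈⟨ ∙-congˡ (identityˡ (z ⁻¹)) ⟩
      x - z                    ∎

    ∼-trans : ∀ {x y z} → x ∼ y → y ∼ z → x ∼ z
    ∼-trans {x} {y} {z} x∼y y∼z = resp (telescope x y z) (∙-closed x∼y y∼z)

    ∼-∙-cong : ∀ {x y u v} → x ∼ y → u ∼ v → (x ∙ u) ∼ (y ∙ v)
    ∼-∙-cong {x} {y} {u} {v} x∼y u∼v =
      resp (trans (interchange x (y ⁻¹) u (v ⁻¹)) (∙-congˡ (⁻¹-∙-comm y v)))
           (∙-closed x∼y u∼v)

    ∼-⁻¹-cong : ∀ {x y} → x ∼ y → (x ⁻¹) ∼ (y ⁻¹)
    ∼-⁻¹-cong {x} {y} x∼y = resp (sym (⁻¹-∙-comm x (y ⁻¹))) (⁻¹-closed x∼y)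

  quotient : AbelianGroup c p
  quotient = record
    { Carrier = Carrier
    ; _≈_     = _∼_
    ; _∙_     = _∙_
    ; ε       = ε
    ; _⁻¹     = _⁻¹
    ; isAbelianGroup = record
      { isGroup = record
        { isMonoid = record
          { isSemigroup = record
            { isMagma = record
              { isEquivalence = record
                { refl = ≈⇒∼ refl ; sym = ∼-sym ; trans = ∼-trans }
              ; ∙-cong = ∼-∙-cong
              }
            ; assoc = λ x y z → ≈⇒∼ (assoc x y z)
            }
          ; identity = (λ x → ≈⇒∼ (identityˡ x)) , (λ x → ≈⇒∼ (identityʳ x))
          }
        ; inverse = (λ x → ≈⇒∼ (inverseˡ x)) , (λ x → ≈⇒∼ (inverseʳ x))
        ; ⁻¹-cong = ∼-⁻¹-cong
        }
      ; comm = λ x y → ≈⇒∼ (comm x y)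
      }
    }

------------------------------------------------------------------------
-- Ext, as Yoneda Ext: extensions 0 → G → E → J → 0 up to equivalence, with
-- all groups in one universe, which plays the role of the universe of sets

record Extension (J G : AbelianGroup ℓ ℓ) : Set (suc ℓ) where
  private
    module J = AbelianGroup J
    module G = AbelianGroup G
  field
    E : AbelianGroup ℓ ℓ
  open AbelianGroup E public using (Carrier; _≈_; rawGroup)
  field
    inj             : G.Carrier → Carrier
    proj            : Carrier → J.Carrier
    inj-mono        : IsGroupMonomorphism G.rawGroup rawGroup inj
    proj-homo       : IsGroupHomomorphism rawGroup J.rawGroup proj
    proj-surjective : Surjective _≈_ J._≈_ proj
    exact           : ∀ e → (proj e J.≈ J.ε) ⇔ (∃[ g ] inj g ≈ e)

record Equivalent {J G : AbelianGroup ℓ ℓ} (X Y : Extension J G) : Set ℓ where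
  private
    module X = Extension X
    module Y = Extension Y
    module J = AbelianGroup J
  field
    φ          : X.Carrier → Y.Carrier
    φ-iso      : IsGroupIsomorphism X.rawGroup Y.rawGroup φ
    φ-inj      : ∀ g → φ (X.inj g) Y.≈ Y.inj g
    φ-proj     : ∀ e → Y.proj (φ e) J.≈ X.proj e

-- The split extension 0 → G → G ⊕ J → J → 0, the zero element of Ext(J,G).

splitExtension : (J G : AbelianGroup ℓ ℓ) → Extension J G
splitExtension J G = record
  { E    = DirectProduct.abelianGroup G J
  ; inj  = λ g → g , J.ε
  ; proj = proj₂
  ; inj-mono = record
    { isGroupHomomorphism = record
      { isMonoidHomomorphism = record
        { isMagmaHomomorphism = record
          { isRelHomomorphism = record { cong = λ g≈h → g≈h , J.refl }
          ; homo = λ _ _ → G.refl , J.sym (J.identityˡ J.ε)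
          }
        ; ε-homo = G.refl , J.refl
        }
      ; ⁻¹-homo = λ _ → G.refl , J.sym (AbelianGroupProperties.ε⁻¹≈ε J)
      }
    ; injective = proj₁
    }
  ; proj-homo = record
    { isMonoidHomomorphism = record
      { isMagmaHomomorphism = record
        { isRelHomomorphism = record { cong = proj₂ }
        ; homo = λ _ _ → J.refl
        }
      ; ε-homo = J.refl
      }
    ; ⁻¹-homo = λ _ → J.refl
    }
  ; proj-surjective = λ j → (G.ε , j) , proj₂
  ; exact = λ e → record
    { to        = λ j≈ε → proj₁ e , G.refl , J.sym j≈ε
    ; from      = λ (_ , _ , ε≈j) → J.sym ε≈j
    ; to-cong   = λ { ≡.refl → ≡.refl }
    ; from-cong = λ { ≡.refl → ≡.refl }
    }
  }
  where
  module J = AbelianGroup J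
  module G = AbelianGroup G

ExtVanishes : (J G : AbelianGroup ℓ ℓ) → Set (suc ℓ)
ExtVanishes J G = (X : Extension J G) → Equivalent X (splitExtension J G)

------------------------------------------------------------------------
-- Cotorsion and cotorsionfree groups

TorsionFree : AbelianGroup c ℓ → Set (c ⊔ ℓ)
TorsionFree G = ∀ n .{{_ : NonZero n}} x → n · x ≈ ε → x ≈ ε
  where
  open AbelianGroup G
  open RawMonoidDefinitions rawMonoid using () renaming (_×_ to _·_)

Cotorsion : AbelianGroup ℓ ℓ → Set (suc ℓ)
Cotorsion {ℓ} G = (J : AbelianGroup ℓ ℓ) → TorsionFree J → ExtVanishes J G

CotorsionFree : AbelianGroup ℓ ℓ → Set (suc ℓ)
CotorsionFree {ℓ} G =
  ¬ (Σ[ H ∈ Subgroup G ℓ ] ¬ Trivial H × Cotorsion (subgroup G H))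

------------------------------------------------------------------------
-- The Baer–Specker group, with pointwise equality

ℤ^ω : AbelianGroup 0ℓ 0ℓ
ℤ^ω = Pointwise.abelianGroup ℕ ℤ.+-0-abelianGroup

------------------------------------------------------------------------
-- Ordinals, as well-ordered sets, and chains indexed by them

record Ordinal ℓ₁ ℓ₂ ℓ₃ : Set (suc (ℓ₁ ⊔ ℓ₂ ⊔ ℓ₃)) where
  field
    strictTotalOrder : StrictTotalOrder ℓ₁ ℓ₂ ℓ₃
  open StrictTotalOrder strictTotalOrder public using (Carrier; _≈_; _<_)
  field
    <-wellFounded : WellFounded _<_
  open StrictToNonStrict _≈_ _<_ public using (_≤_)

Ascending : {G : AbelianGroup c ℓ} (δ : Ordinal ℓ₁ ℓ₂ ℓ₃) →
            (Ordinal.Carrier δ → Subgroup G p) → Set _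
Ascending δ A = ∀ {α β} → α ≤ β → A α ≤ₛ A β
  where open Ordinal δ

{-# OPTIONS --safe #-}
-- If every system d n · g (n+1) = g n + a n is solvable in G, then Ext(J , G) = 0 for torsionfree J:
-- by Zorn's lemma an extension E has a subgroup K maximal among those meeting G trivially with
-- E / (K + G) torsionfree, and if K + G ≠ E, a rank-one pure subgroup of E / (K + G) is a union of
-- cyclic groups, whose generators can be corrected by a solution of such a system so that they
-- enlarge K.  A similar argument applies to groups G of prime exponent, so a cotorsionfree group is
-- torsionfree.  The systems are solvable in divisible groups and in the quotients of ℤ^ω / ⊕ℤ, so a
-- cotorsionfree group is reduced, and a proper A with ℤ^ω / A cotorsionfree misses some unit vector.
--
-- Given a chain that covers ℤ^ω, choose for every n a member of the chain containing the n-th unit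
-- vector.  No member contains all unit vectors, so these countably many members cover ℤ^ω.  As the
-- quotients are reduced, each member is closed in the complete group of sequences x with i! ∣ x i,
-- so by Baire's theorem one of them contains all such sequences supported on [m , ∞).  The quotient
-- being torsionfree, it contains the unit vectors with index ≥ m, and a larger member of the chain
-- contains the remaining ones too, a contradiction.
module Submission where

open import Defs
open import Level using (Level; 0ℓ; _⊔_)
open import Algebra.Bundles using (AbelianGroup)
open import Algebra.Morphism.Structures using (IsGroupHomomorphism; IsGroupMonomorphism)
import Algebra.Properties.AbelianGroup as AbelianGroupProperties
import Algebra.Properties.CommutativeMonoid.Mult as Mult
import Algebra.Properties.CommutativeSemigroup as CommutativeSemigroupProperties
open import Axiom.ExcludedMiddle using (ExcludedMiddle)
open import Axiom.Extensionality.Propositional using (Extensionality)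
open import Data.Bool.Base using (Bool; true; false; T; if_then_else_)
open import Data.Empty using (⊥-elim)
open import Data.Fin.Base using (Fin; zero; suc)
open import Data.Integer.Base as ℤ using (ℤ; +_; -[1+_]; 0ℤ; 1ℤ)
import Data.Integer.Properties as ℤ
open import Data.List.Base using ([]; _∷_)
open import Data.List.Relation.Unary.All using (All; []; _∷_)
open import Data.Nat.Base as ℕ using (ℕ; zero; suc; NonZero; s≤s; z≤n; _!)
open import Data.Nat.Coprimality using (Coprime; coprime-Bézout)
open import Data.Nat.Divisibility using (_∣_; _∣?_; divides; ∣-trans; m∣m*n; m≤n⇒m!∣n!)
open import Data.Nat.GCD using (module Bézout)
open import Data.Nat.ListAction using (product)
open import Data.Nat.Primality using (Prime; prime⇒nonZero; prime⇒irreducible)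
open import Data.Nat.Primality.Factorisation using (factorise; PrimeFactorisation)
import Data.Nat.Properties as ℕ
open import Data.Product.Base using (Σ-syntax; ∃-syntax; _×_; _,_; proj₁; proj₂)
open import Data.Sum.Base as Sum using (_⊎_; inj₁; inj₂; [_,_]′)
open import Data.Unit.Base using (⊤; tt)
open import Data.Vec.Base using (Vec; []; _∷_; lookup; replicate; zipWith; map)
open import Function.Base using (_∘_)
open import Function.Bundles using (module Equivalence)
open import Relation.Binary.Bundles using (module StrictTotalOrder)
open import Relation.Binary.Definitions using (tri<; tri≈; tri>)
import Relation.Binary.PropositionalEquality as ≡
open ≡ using (_≡_; _≢_)
import Relation.Binary.Reasoning.Setoid as SetoidReasoning
import Relation.Binary.Reflection as Reflection
open import Relation.Nullary.Decidable using (Dec; yes; no; does; dec-true; dec-false)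
open import Relation.Nullary.Negation.Core using (¬_; contradiction)
open import Relation.Unary using (Pred; _∈_; _⊆_; _≐_; U; ⋃)

private
  variable
    c ℓ c′ ℓ′ p q : Level

-- Integer multiples, cyclic subgroups and quotients

module IntegerMultiples (G : AbelianGroup c ℓ) where
  open AbelianGroup G
  open AbelianGroupProperties G public
  open Mult commutativeMonoid public renaming (_×_ to _·_)
  open CommutativeSemigroupProperties commutativeSemigroup using (interchange)
  open SetoidReasoning setoid

  infixr 8 _⋆_

  _⋆_ : ℤ → Carrier → Carrier
  (+ n)      ⋆ x = n · x
  (-[1+ n ]) ⋆ x = (suc n · x) ⁻¹

  ε-ε≈ε : ε - ε ≈ ε
  ε-ε≈ε = inverseʳ ε

  -‿∙-interchange : ∀ w x y z → (w - x) ∙ (y - z) ≈ (w ∙ y) - (x ∙ z)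
  -‿∙-interchange w x y z = trans (interchange w (x ⁻¹) y (z ⁻¹)) (∙-congˡ (⁻¹-∙-comm x z))

  -- Sums of integers with opposite signs compute to `⊖`, so this is the mixed-sign case of
  -- `⋆-homo-+`.
  ⊖-⋆ : ∀ m n x → (m ℤ.⊖ n) ⋆ x ≈ m · x - n · x
  ⊖-⋆ m       zero    x = sym (trans (∙-congˡ ε⁻¹≈ε) (identityʳ (m · x)))
  ⊖-⋆ zero    (suc n) x = sym (identityˡ _)
  ⊖-⋆ (suc m) (suc n) x = begin
    (suc m ℤ.⊖ suc n) ⋆ x          ≡⟨ ≡.cong (_⋆ x) (ℤ.[1+m]⊖[1+n]≡m⊖n m n) ⟩
    (m ℤ.⊖ n) ⋆ x                  ≈⟨ ⊖-⋆ m n x ⟩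
    m · x - n · x                  ≈⟨ identityˡ _ ⟨
    ε ∙ (m · x - n · x)            ≈⟨ ∙-congʳ (inverseʳ x) ⟨
    (x - x) ∙ (m · x - n · x)      ≈⟨ -‿∙-interchange x x (m · x) (n · x) ⟩
    (x ∙ m · x) - (x ∙ n · x)      ∎

  ⋆-homo-+ : ∀ i j x → (i ℤ.+ j) ⋆ x ≈ i ⋆ x ∙ j ⋆ x
  ⋆-homo-+ (+ m)      (+ n)      x = ×-homo-+ x m n
  ⋆-homo-+ (+ m)      (-[1+ n ]) x = ⊖-⋆ m (suc n) x
  ⋆-homo-+ (-[1+ m ]) (+ n)      x = trans (⊖-⋆ n (suc m) x) (comm _ _)
  ⋆-homo-+ (-[1+ m ]) (-[1+ n ]) x = begin
    (suc (suc (m ℕ.+ n)) · x) ⁻¹          ≡⟨ ≡.cong (λ k → (suc k · x) ⁻¹) (ℕ.+-suc m n) ⟨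
    ((suc m ℕ.+ suc n) · x) ⁻¹            ≈⟨ ⁻¹-cong (×-homo-+ x (suc m) (suc n)) ⟩
    (suc m · x ∙ suc n · x) ⁻¹            ≈⟨ ⁻¹-∙-comm _ _ ⟨
    (suc m · x) ⁻¹ ∙ (suc n · x) ⁻¹       ∎

  ⋆-homo-- : ∀ i x → (ℤ.- i) ⋆ x ≈ (i ⋆ x) ⁻¹
  ⋆-homo-- (+ zero)   x = sym ε⁻¹≈ε
  ⋆-homo-- (+ suc n)  x = refl
  ⋆-homo-- (-[1+ n ]) x = sym (⁻¹-involutive _)

  ⋆-identity : ∀ x → 1ℤ ⋆ x ≈ x
  ⋆-identity = identityʳ

  ·-⁻¹ : ∀ n x → n · (x ⁻¹) ≈ (n · x) ⁻¹
  ·-⁻¹ zero    x = sym ε⁻¹≈ε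
  ·-⁻¹ (suc n) x = trans (∙-congˡ (·-⁻¹ n x)) (⁻¹-∙-comm x (n · x))

  ·-distrib-- : ∀ n x y → n · (x - y) ≈ n · x - n · y
  ·-distrib-- n x y = trans (×-distrib-+ x (y ⁻¹) n) (∙-congˡ (·-⁻¹ n y))

  ·-ε : ∀ n → n · ε ≈ ε
  ·-ε zero    = refl
  ·-ε (suc n) = trans (identityˡ _) (·-ε n)

  ·-comm : ∀ m n x → m · n · x ≈ n · m · x
  ·-comm m n x = begin
    m · n · x      ≈⟨ ×-assocˡ x m n ⟩
    (m ℕ.* n) · x  ≡⟨ ≡.cong (_· x) (ℕ.*-comm m n) ⟩
    (n ℕ.* m) · x  ≈⟨ ×-assocˡ x n m ⟨
    n · m · x      ∎

  ·-⋆-comm : ∀ m i x → m · i ⋆ x ≈ i ⋆ m · x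
  ·-⋆-comm m (+ n)      x = ·-comm m n x
  ·-⋆-comm m (-[1+ n ]) x = trans (·-⁻¹ m (suc n · x)) (⁻¹-cong (·-comm m (suc n) x))

  ⋆-congʳ : ∀ i {x y} → x ≈ y → i ⋆ x ≈ i ⋆ y
  ⋆-congʳ (+ n)      x≈y = ×-congʳ n x≈y
  ⋆-congʳ (-[1+ n ]) x≈y = ⁻¹-cong (×-congʳ (suc n) x≈y)

-- Equations between words are decided by comparing their integer exponent vectors.

module AbelianGroupSolver (G : AbelianGroup c ℓ) where
  open AbelianGroup G
  open IntegerMultiples G
  open CommutativeSemigroupProperties commutativeSemigroup using (interchange)

  infixl 7 _⊕_ _⊝_
  infix  8 ⊖_

  data Expr (n : ℕ) : Set where
    var : Fin n → Expr n
    _⊕_ : Expr n → Expr n → Expr n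
    ⊖_  : Expr n → Expr n

  _⊝_ : ∀ {n} → Expr n → Expr n → Expr n
  a ⊝ b = a ⊕ ⊖ b

  ⟦_⟧ : ∀ {n} → Expr n → Vec Carrier n → Carrier
  ⟦ var i ⟧ ρ = lookup ρ i
  ⟦ a ⊕ b ⟧ ρ = ⟦ a ⟧ ρ ∙ ⟦ b ⟧ ρ
  ⟦ ⊖ a   ⟧ ρ = (⟦ a ⟧ ρ) ⁻¹

  unit : ∀ {n} → Fin n → Vec ℤ n
  unit zero    = 1ℤ ∷ replicate _ 0ℤ
  unit (suc i) = 0ℤ ∷ unit i

  exponents : ∀ {n} → Expr n → Vec ℤ n
  exponents (var i) = unit i
  exponents (a ⊕ b) = zipWith ℤ._+_ (exponents a) (exponents b)
  exponents (⊖ a)   = map ℤ.-_ (exponents a)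

  combine : ∀ {n} → Vec ℤ n → Vec Carrier n → Carrier
  combine []      []      = ε
  combine (i ∷ v) (x ∷ ρ) = i ⋆ x ∙ combine v ρ

  combine-0 : ∀ {n} (ρ : Vec Carrier n) → combine (replicate n 0ℤ) ρ ≈ ε
  combine-0 []      = refl
  combine-0 (x ∷ ρ) = trans (identityˡ _) (combine-0 ρ)

  combine-unit : ∀ {n} (i : Fin n) ρ → combine (unit i) ρ ≈ lookup ρ i
  combine-unit zero    (x ∷ ρ) = trans (∙-cong (⋆-identity x) (combine-0 ρ)) (identityʳ x)
  combine-unit (suc i) (x ∷ ρ) = trans (identityˡ _) (combine-unit i ρ)

  combine-+ : ∀ {n} (u v : Vec ℤ n) ρ →
              combine (zipWith ℤ._+_ u v) ρ ≈ combine u ρ ∙ combine v ρ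
  combine-+ []      []      []      = sym (identityˡ ε)
  combine-+ (i ∷ u) (j ∷ v) (x ∷ ρ) =
    trans (∙-cong (⋆-homo-+ i j x) (combine-+ u v ρ)) (interchange _ _ _ _)

  combine-- : ∀ {n} (u : Vec ℤ n) ρ → combine (map ℤ.-_ u) ρ ≈ (combine u ρ) ⁻¹
  combine-- []      []      = sym ε⁻¹≈ε
  combine-- (i ∷ u) (x ∷ ρ) = trans (∙-cong (⋆-homo-- i x) (combine-- u ρ)) (⁻¹-∙-comm _ _)

  correct : ∀ {n} (a : Expr n) ρ → combine (exponents a) ρ ≈ ⟦ a ⟧ ρ
  correct (var i) ρ = combine-unit i ρ
  correct (a ⊕ b) ρ =
    trans (combine-+ (exponents a) (exponents b) ρ) (∙-cong (correct a ρ) (correct b ρ))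
  correct (⊖ a)   ρ = trans (combine-- (exponents a) ρ) (⁻¹-cong (correct a ρ))

  open Reflection setoid var ⟦_⟧ (λ a → combine (exponents a)) correct public
    using (solve; _⊜_)

module Homomorphism
  {G : AbelianGroup c ℓ} {H : AbelianGroup c′ ℓ′}
  {f : AbelianGroup.Carrier G → AbelianGroup.Carrier H}
  (isHomo : IsGroupHomomorphism (AbelianGroup.rawGroup G) (AbelianGroup.rawGroup H) f) where
  private
    module G = AbelianGroup G
    module H = AbelianGroup H
    module MG = IntegerMultiples G
    module MH = IntegerMultiples H
  open IsGroupHomomorphism isHomo public

  ·-homo : ∀ n x → f (n MG.· x) H.≈ n MH.· f x
  ·-homo zero    x = ε-homo
  ·-homo (suc n) x = H.trans (homo x (n MG.· x)) (H.∙-congˡ (·-homo n x))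

  -‿homo : ∀ x y → f (x G.- y) H.≈ f x H.- f y
  -‿homo x y = H.trans (homo x (y G.⁻¹)) (H.∙-congˡ (⁻¹-homo y))

  preimage : Subgroup H p → Subgroup G p
  preimage S = record
    { member    = λ x → f x ∈ S.member
    ; resp      = λ x≈y → S.resp (⟦⟧-cong x≈y)
    ; ε-closed  = S.resp (H.sym ε-homo) S.ε-closed
    ; ∙-closed  = λ x∈S y∈S → S.resp (H.sym (homo _ _)) (S.∙-closed x∈S y∈S)
    ; ⁻¹-closed = λ x∈S → S.resp (H.sym (⁻¹-homo _)) (S.⁻¹-closed x∈S)
    }
    where module S = Subgroup S

module Subgroups {G : AbelianGroup c ℓ} (S : Subgroup G p) where
  open AbelianGroup G
  open IntegerMultiples G
  open Subgroup S public

  -‿closed : ∀ {x y} → x ∈ member → y ∈ member → (x - y) ∈ member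
  -‿closed x∈S y∈S = ∙-closed x∈S (⁻¹-closed y∈S)

  ·-closed : ∀ n {x} → x ∈ member → n · x ∈ member
  ·-closed zero    x∈S = ε-closed
  ·-closed (suc n) x∈S = ∙-closed x∈S (·-closed n x∈S)

  ⋆-closed : ∀ i {x} → x ∈ member → i ⋆ x ∈ member
  ⋆-closed (+ n)      x∈S = ·-closed n x∈S
  ⋆-closed (-[1+ n ]) x∈S = ⁻¹-closed (·-closed (suc n) x∈S)

  ∣⋆∣-closed : ∀ i {x} → i ⋆ x ∈ member → ℤ.∣ i ∣ · x ∈ member
  ∣⋆∣-closed (+ n)      nx∈S  = nx∈S
  ∣⋆∣-closed (-[1+ n ]) -nx∈S = resp (⁻¹-involutive _) (⁻¹-closed -nx∈S)

  ∣⋆∣-closed⁻ : ∀ i {x} → ℤ.∣ i ∣ · x ∈ member → i ⋆ x ∈ member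
  ∣⋆∣-closed⁻ (+ n)      nx∈S = nx∈S
  ∣⋆∣-closed⁻ (-[1+ n ]) nx∈S = ⁻¹-closed nx∈S

  ∣·-closed : ∀ {m n x} → m ∣ n → m · x ∈ member → n · x ∈ member
  ∣·-closed {m} {x = x} (divides k ≡.refl) mx∈S = resp (×-assocˡ x k m) (·-closed k mx∈S)

  coprime-closed : ∀ {m n x} → Coprime m n → m · x ∈ member → n · x ∈ member → x ∈ member
  coprime-closed {m} {n} {x} m⊥n mx∈S nx∈S = bézout (coprime-Bézout m⊥n)
    where
    -- Over the naturals Bézout's identity has two forms, according to which product is larger. Both
    -- reduce to x = a x - b x with a = 1 + b.
    remainder : ∀ a b → 1 ℕ.+ b ≡ a → a · x ∈ member → b · x ∈ member → x ∈ member
    remainder _ b ≡.refl ax∈S bx∈S =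
      resp (trans (assoc x (b · x) _) (trans (∙-congˡ (inverseʳ (b · x))) (identityʳ x)))
           (-‿closed ax∈S bx∈S)

    am∈S : ∀ a → (a ℕ.* m) · x ∈ member
    am∈S a = ∣·-closed (divides a ≡.refl) mx∈S

    bn∈S : ∀ b → (b ℕ.* n) · x ∈ member
    bn∈S b = ∣·-closed (divides b ≡.refl) nx∈S

    bézout : Bézout.Identity 1 m n → x ∈ member
    bézout (Bézout.+- a b 1+bn≡am) = remainder (a ℕ.* m) (b ℕ.* n) 1+bn≡am (am∈S a) (bn∈S b)
    bézout (Bézout.-+ a b 1+am≡bn) = remainder (b ℕ.* n) (a ℕ.* m) 1+am≡bn (bn∈S b) (am∈S a)

module _ (G : AbelianGroup c ℓ) where
  open AbelianGroup G
  open IntegerMultiples G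

  cyclic : Carrier → Subgroup G ℓ
  cyclic z = record
    { member    = λ x → ∃[ i ] x ≈ i ⋆ z
    ; resp      = λ x≈y (i , x≈iz) → i , trans (sym x≈y) x≈iz
    ; ε-closed  = 0ℤ , refl
    ; ∙-closed  = λ (i , x≈iz) (j , y≈jz) →
        i ℤ.+ j , trans (∙-cong x≈iz y≈jz) (sym (⋆-homo-+ i j z))
    ; ⁻¹-closed = λ (i , x≈iz) → ℤ.- i , trans (⁻¹-cong x≈iz) (sym (⋆-homo-- i z))
    }

  infix 4 _∈⟨_⟩

  _∈⟨_⟩ : Carrier → Carrier → Set ℓ
  x ∈⟨ z ⟩ = x ∈ Subgroup.member (cyclic z)

  ∈⟨⟩-self : ∀ z → z ∈⟨ z ⟩
  ∈⟨⟩-self z = 1ℤ , sym (⋆-identity z)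

  ∈⟨⟩-least : (S : Subgroup G p) → ∀ {x z} → z ∈ Subgroup.member S → x ∈⟨ z ⟩ →
              x ∈ Subgroup.member S
  ∈⟨⟩-least S z∈S (i , x≈iz) = resp (sym x≈iz) (⋆-closed i z∈S)
    where open Subgroups S

module _ (G : AbelianGroup c ℓ) where
  open AbelianGroup G

  union : {I : Set q} (S : I → Subgroup G p) → I →
          (∀ i j → ∃[ k ] S i ≤ₛ S k × S j ≤ₛ S k) → Subgroup G _
  union S i₀ directed = record
    { member    = λ x → ∃[ i ] x ∈ Subgroup.member (S i)
    ; resp      = λ x≈y (i , x∈S) → i , Subgroup.resp (S i) x≈y x∈S
    ; ε-closed  = i₀ , Subgroup.ε-closed (S i₀)
    ; ∙-closed  = λ (i , x∈S) (j , y∈S) → let k , i≤k , j≤k = directed i j in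
        k , Subgroup.∙-closed (S k) (i≤k x∈S) (j≤k y∈S)
    ; ⁻¹-closed = λ (i , x∈S) → i , Subgroup.⁻¹-closed (S i) x∈S
    }

module _ (G : AbelianGroup c ℓ) (A : Subgroup G p) where
  open AbelianGroup G
  open AbelianGroupProperties G
  open AbelianGroupSolver G
  open Subgroups A

  ≈⇒∼ : ∀ {x y} → x ≈ y → (x - y) ∈ member
  ≈⇒∼ x≈y = resp (sym (x≈y⇒x∙y⁻¹≈ε x≈y)) ε-closed

  ∈⇒∼ε : ∀ {x} → x ∈ member → (x - ε) ∈ member
  ∈⇒∼ε {x} = resp (sym (trans (∙-congˡ ε⁻¹≈ε) (identityʳ x)))

  ∼ε⇒∈ : ∀ {x} → (x - ε) ∈ member → x ∈ member
  ∼ε⇒∈ {x} = resp (trans (∙-congˡ ε⁻¹≈ε) (identityʳ x))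

  quotient-homo : IsGroupHomomorphism rawGroup (AbelianGroup.rawGroup (quotient G A)) (λ x → x)
  quotient-homo = record
    { isMonoidHomomorphism = record
      { isMagmaHomomorphism = record
        { isRelHomomorphism = record { cong = ≈⇒∼ }
        ; homo = λ x y → ≈⇒∼ refl
        }
      ; ε-homo = ≈⇒∼ refl
      }
    ; ⁻¹-homo = λ x → ≈⇒∼ refl
    }

  module _ (B : Subgroup G p) (A≤B : A ≤ₛ B) where
    private module B = Subgroup B

    -- Since `quotient` keeps the carrier, the members do not change. That A lies in B is what makes
    -- them respect congruence modulo A.
    image : Subgroup (quotient G A) p
    image = record
      { member    = B.member
      ; resp      = λ {x} {y} x∼y x∈B → B.resp (solve 2 (λ x y → (x ⊝ (x ⊝ y)) ⊜ y) refl x y)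
                      (B.∙-closed x∈B (B.⁻¹-closed (A≤B x∼y)))
      ; ε-closed  = B.ε-closed
      ; ∙-closed  = B.∙-closed
      ; ⁻¹-closed = B.⁻¹-closed
      }

  private
    module Q  = AbelianGroup (quotient G A)
    module MQ = IntegerMultiples (quotient G A)
  open IntegerMultiples G using (_·_; ·-⁻¹)

  -- The multiple on the right is formed in G / A. For a variable n the two sides are different
  -- terms, although the operations agree.
  quotient-· : ∀ n x → (n · x) Q.≈ (n MQ.· x)
  quotient-· = Homomorphism.·-homo {G = G} {H = quotient G A} quotient-homo

  ∈⇒quotient-· : ∀ n {x y} → (n · x - y) ∈ member → (n MQ.· x) Q.≈ y
  ∈⇒quotient-· n {x} {y} nx-y∈A = Q.trans (Q.sym (quotient-· n x)) nx-y∈A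

  quotient-torsionFree⁻ : TorsionFree (quotient G A) →
                          ∀ n .{{_ : NonZero n}} {x} → n · x ∈ member → x ∈ member
  quotient-torsionFree⁻ torsionFree n {x} nx∈A =
    ∼ε⇒∈ (torsionFree n x (∈⇒quotient-· n (∈⇒∼ε nx∈A)))

  ∙·∈⇒quotient-· : ∀ n {v w g} → w ≈ n · g → (v ∙ w) ∈ member → (n MQ.· (g ⁻¹)) Q.≈ v
  ∙·∈⇒quotient-· n {v} {w} {g} w≈ng vw∈A = ∈⇒quotient-· n (resp (sym (begin
    n · (g ⁻¹) - v  ≈⟨ ∙-congʳ (trans (·-⁻¹ n g) (⁻¹-cong (sym w≈ng))) ⟩
    w ⁻¹ - v        ≈⟨ solve 2 (λ v w → (⊖ w ⊝ v) ⊜ (⊖ (v ⊕ w))) refl v w ⟩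
    (v ∙ w) ⁻¹      ∎)) (⁻¹-closed vw∈A))
    where open SetoidReasoning setoid

-- Zorn's lemma

module Classical (em : ∀ ℓ → ExcludedMiddle ℓ) where

  by-contradiction : {P : Set p} → ¬ ¬ P → P
  by-contradiction {p} {P} ¬¬P with em p {P}
  ... | yes P! = P!
  ... | no ¬P = contradiction ¬P ¬¬P

  ¬∀⇒∃¬ : ∀ {a} {A : Set a} {P : A → Set p} → ¬ (∀ x → P x) → ∃[ x ] ¬ P x
  ¬∀⇒∃¬ ¬∀ = by-contradiction λ ¬∃ → ¬∀ λ x → by-contradiction λ ¬Px → ¬∃ (x , ¬Px)

  truth : Set → Bool
  truth P = does (em 0ℓ {P})

  truth⁺ : {P : Set} → P → T (truth P)
  truth⁺ {P} P! with em 0ℓ {P}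
  ... | yes _ = _
  ... | no ¬P = ¬P P!

  truth⁻ : {P : Set} → T (truth P) → P
  truth⁻ {P} t with em 0ℓ {P}
  ... | yes P! = P!

-- Subsets are Boolean-valued, so that the family of all subsets in the tower is again small and
-- its union is a subset.

module Zorn
  (em : ∀ ℓ → ExcludedMiddle ℓ) (fe : ∀ a b → Extensionality a b)
  {X : Set} (𝒫 : Pred X 0ℓ → Set) (S₀ : Pred X 0ℓ)
  -- Boolean coding recovers a predicate only up to `≐`, so both closure conditions are asked of
  -- every predicate with the right elements.
  (base∈𝒫  : ∀ {U} → U ≐ S₀ → 𝒫 U)
  (chain∈𝒫 : ∀ {I : Set} → I → (F : I → Pred X 0ℓ) → (∀ i → 𝒫 (F i)) →
             (∀ i j → F i ⊆ F j ⊎ F j ⊆ F i) →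
             ∀ {U} → U ≐ (λ x → ∃[ i ] x ∈ F i) → 𝒫 U)
  where
  open Classical em

  private
    Subset : Set
    Subset = X → Bool

    El : Subset → Pred X 0ℓ
    El S x = T (S x)

    ⌊_⌋ : Pred X 0ℓ → Subset
    ⌊ P ⌋ x = truth (P x)

    El-⌊⌋ : (P : Pred X 0ℓ) → El ⌊ P ⌋ ≐ P
    El-⌊⌋ P = (λ {x} → truth⁻ {P x}) , truth⁺

    infix 4 _⊑_

    _⊑_ : Subset → Subset → Set
    S ⊑ S′ = El S ⊆ El S′

    T-injective : ∀ {a b} → (T a → T b) → (T b → T a) → a ≡ b
    T-injective {false} {false} f g = ≡.refl
    T-injective {false} {true}  f g = ⊥-elim (g _)
    T-injective {true}  {false} f g = ⊥-elim (f _)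
    T-injective {true}  {true}  f g = ≡.refl

    ⊑-antisym : ∀ {S S′} → S ⊑ S′ → S′ ⊑ S → S ≡ S′
    ⊑-antisym S⊑S′ S′⊑S = fe 0ℓ 0ℓ λ x → T-injective S⊑S′ S′⊑S

    StrictExtension : Subset → Set
    StrictExtension S = Σ[ S′ ∈ Subset ] 𝒫 (El S′) × S ⊑ S′ × ¬ S′ ⊑ S

    -- Excluded middle at a Σ-type returns an actual extension and so serves as the choice function.
    -- The decision is an argument so that `next` unfolds once it is matched.
    next′ : ∀ S → Dec (StrictExtension S) → Subset
    next′ S (yes (S′ , _)) = S′
    next′ S (no _)         = S

    next : Subset → Subset
    next S = next′ S (em 0ℓ)

    next-inflationary : ∀ S → S ⊑ next S
    next-inflationary S with em 0ℓ {StrictExtension S}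
    ... | yes (_ , _ , S⊑S′ , _) = S⊑S′
    ... | no _                   = λ x → x

    next∈𝒫 : ∀ S → 𝒫 (El S) → 𝒫 (El (next S))
    next∈𝒫 S S∈𝒫 with em 0ℓ {StrictExtension S}
    ... | yes (_ , S′∈𝒫 , _) = S′∈𝒫
    ... | no _               = S∈𝒫

    sup : (Subset → Bool) → Subset
    sup M = ⌊ (λ x → ∃[ S ] T (M S) × x ∈ El S) ⌋

    sup⁺ : ∀ {M S x} → T (M S) → x ∈ El S → x ∈ El (sup M)
    sup⁺ S∈M x∈S = truth⁺ (_ , S∈M , x∈S)

    sup⁻ : ∀ {M x} → x ∈ El (sup M) → ∃[ S ] T (M S) × x ∈ El S
    sup⁻ {M} {x} = truth⁻ {∃[ S ] T (M S) × x ∈ El S}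

    -- As in the Bourbaki-Witt theorem, this is the least family containing S₀ and closed under
    -- `next` and nonempty unions. It will be shown to be linearly ordered, so its union is its
    -- greatest member.
    data Tower : Subset → Set where
      base : Tower ⌊ S₀ ⌋
      succ : ∀ {S} → Tower S → Tower (next S)
      lim  : ∀ M → ∃[ S ] T (M S) → (∀ S → T (M S) → Tower S) → Tower (sup M)

    base⊑ : ∀ {S} → Tower S → ⌊ S₀ ⌋ ⊑ S
    base⊑ base                    x∈ = x∈
    base⊑ (succ {S} t)            x∈ = next-inflationary S (base⊑ t x∈)
    base⊑ (lim M (S , S∈M) tower) x∈ = sup⁺ S∈M (base⊑ (tower S S∈M) x∈)

    -- Sharper than comparability: nothing in the tower lies strictly between S′ and `next S′`. This
    -- stronger form is what survives the induction.
    Below : Subset → Subset → Set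
    Below S S′ = S ⊑ S′ ⊎ next S′ ⊑ S

    below-base : ∀ {S} → Tower S → Below ⌊ S₀ ⌋ S
    below-base t = inj₁ (base⊑ t)

    below-succ : ∀ {S S′} → Below S S′ → Below S′ S → Below (next S) S′
    below-succ {S} S≤S′ (inj₂ next⊑) = inj₁ next⊑
    below-succ {S} (inj₁ S⊑S′) (inj₁ S′⊑S) =
      -- S and S′ have the same elements, hence are equal by extensionality, and `next` chooses the
      -- same extension for both.
      inj₂ λ {x} → ≡.subst (λ R → T (next R x)) (⊑-antisym S′⊑S S⊑S′)
    below-succ {S} (inj₂ next⊑S) (inj₁ S′⊑S) = inj₂ (next-inflationary S ∘ next⊑S)

    below-sup : ∀ M {S′} → (∀ S → T (M S) → Below S S′) → Below (sup M) S′
    below-sup M {S′} M≤S′ with em 0ℓ {∃[ S ] T (M S) × next S′ ⊑ S}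
    ... | yes (S , S∈M , next⊑S) = inj₂ λ x∈ → sup⁺ S∈M (next⊑S x∈)
    ... | no ¬above = inj₁ λ x∈ → let S , S∈M , x∈S = sup⁻ x∈ in
      [ (λ S⊑S′ → S⊑S′ x∈S) , (λ next⊑S → contradiction (S , S∈M , next⊑S) ¬above) ]′ (M≤S′ S S∈M)

    -- The inner induction, on S′: it reverses the roles of S and S′ once S is known to compare with
    -- the whole tower. The successor case of `below` calls it.
    below-given : ∀ {S S′} → Tower S → (∀ {R} → Tower R → Below S R) → Tower S′ → Below S′ S
    below-given t S≤ base            = below-base t
    below-given t S≤ (succ u)        = below-succ (below-given t S≤ u) (S≤ u)
    below-given t S≤ (lim M _ tower) = below-sup M λ S S∈M → below-given t S≤ (tower S S∈M)

    below : ∀ {S S′} → Tower S → Tower S′ → Below S S′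
    below base            u = below-base u
    below (succ t)        u = below-succ (below t u) (below-given t (below t) u)
    below (lim M _ tower) u = below-sup M λ S S∈M → below (tower S S∈M) u

    total : ∀ {S S′} → Tower S → Tower S′ → S ⊑ S′ ⊎ S′ ⊑ S
    total {S} {S′} t u = Sum.map₂ (λ next⊑ x∈ → next⊑ (next-inflationary S′ x∈)) (below t u)

    tower∈𝒫 : ∀ {S} → Tower S → 𝒫 (El S)
    tower∈𝒫 base = base∈𝒫 (El-⌊⌋ S₀)
    tower∈𝒫 (succ {S} t) = next∈𝒫 S (tower∈𝒫 t)
    tower∈𝒫 (lim M (S , S∈M) tower) =
      chain∈𝒫 {I = ∃[ R ] T (M R)} (S , S∈M) (λ (R , _) → El R)
        (λ (R , R∈M) → tower∈𝒫 (tower R R∈M))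
        (λ (R , R∈M) (R′ , R′∈M) → total (tower R R∈M) (tower R′ R′∈M))
        ( (λ x∈ → let R , R∈M , x∈R = sup⁻ x∈ in (R , R∈M) , x∈R)
        , (λ ((R , R∈M) , x∈R) → sup⁺ R∈M x∈R))

    all : Subset → Bool
    all S = truth (Tower S)

    top : Subset
    top = sup all

    top∈Tower : Tower top
    top∈Tower = lim all (_ , truth⁺ base) (λ S → truth⁻)

    top-greatest : ∀ {S} → Tower S → S ⊑ top
    top-greatest t = sup⁺ (truth⁺ t)

    -- `next top` is again in the tower, hence contained in `top`; but `next` would have enlarged
    -- `top` if it could.
    top-maximal : ¬ StrictExtension top
    top-maximal ext with em 0ℓ {StrictExtension top} | top-greatest (succ top∈Tower)
    ... | yes (S , _ , _ , S⋢top) | next⊑top = S⋢top next⊑top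
    ... | no ¬ext                 | _        = ¬ext ext

  maximal : ∃[ K ] 𝒫 K × (∀ K′ → 𝒫 K′ → K ⊆ K′ → K′ ⊆ K)
  maximal = El top , tower∈𝒫 top∈Tower , λ K′ K′∈𝒫 top⊆K′ → by-contradiction λ K′⊈top →
    top-maximal
      ( ⌊ K′ ⌋
      -- A chain with one member transports `𝒫` from K′ to its Boolean code.
      , chain∈𝒫 tt (λ _ → K′) (λ _ → K′∈𝒫) (λ _ _ → inj₁ λ x∈ → x∈)
          ((λ x∈ → tt , truth⁻ x∈) , λ (_ , x∈) → truth⁺ x∈)
      , (λ x∈ → truth⁺ (top⊆K′ x∈))
      , (λ K′⊑top → K′⊈top λ x∈ → K′⊑top (truth⁺ x∈)))

-- Zorn's lemma for subgroups

module SubgroupZorn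
  (em : ∀ ℓ → ExcludedMiddle ℓ) (fe : ∀ a b → Extensionality a b)
  (G : AbelianGroup 0ℓ 0ℓ) (𝒫 : Subgroup G 0ℓ → Set) (S₀ : Subgroup G 0ℓ)
  (base∈𝒫  : ∀ S → Subgroup.member S ≐ Subgroup.member S₀ → 𝒫 S)
  (chain∈𝒫 : ∀ {I : Set} → I → (F : I → Subgroup G 0ℓ) → (∀ i → 𝒫 (F i)) →
             (∀ i j → F i ≤ₛ F j ⊎ F j ≤ₛ F i) →
             ∀ S → Subgroup.member S ≐ (λ x → ∃[ i ] x ∈ Subgroup.member (F i)) → 𝒫 S)
  where
  open AbelianGroup G

  private
    record IsSubgroup (K : Pred Carrier 0ℓ) : Set where
      field
        resp      : ∀ {x y} → x ≈ y → x ∈ K → y ∈ K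
        ε-closed  : ε ∈ K
        ∙-closed  : ∀ {x y} → x ∈ K → y ∈ K → (x ∙ y) ∈ K
        ⁻¹-closed : ∀ {x} → x ∈ K → (x ⁻¹) ∈ K

      asSubgroup : Subgroup G 0ℓ
      asSubgroup = record
        { member = K ; resp = resp ; ε-closed = ε-closed
        ; ∙-closed = ∙-closed ; ⁻¹-closed = ⁻¹-closed }

    open IsSubgroup using (asSubgroup)

    isSubgroup : ∀ {K} (S : Subgroup G 0ℓ) → K ≐ Subgroup.member S → IsSubgroup K
    isSubgroup S (K⊆S , S⊆K) = record
      { resp      = λ x≈y x∈K → S⊆K (S.resp x≈y (K⊆S x∈K))
      ; ε-closed  = S⊆K S.ε-closed
      ; ∙-closed  = λ x∈K y∈K → S⊆K (S.∙-closed (K⊆S x∈K) (K⊆S y∈K))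
      ; ⁻¹-closed = λ x∈K → S⊆K (S.⁻¹-closed (K⊆S x∈K))
      }
      where module S = Subgroup S

    𝒫′ : Pred Carrier 0ℓ → Set
    𝒫′ K = Σ[ K-sub ∈ IsSubgroup K ] 𝒫 (asSubgroup K-sub)

    directed : ∀ {I : Set} (F : I → Subgroup G 0ℓ) → (∀ i j → F i ≤ₛ F j ⊎ F j ≤ₛ F i) →
               ∀ i j → ∃[ k ] F i ≤ₛ F k × F j ≤ₛ F k
    directed F total i j with total i j
    ... | inj₁ Fi≤Fj = j , Fi≤Fj , λ x∈ → x∈
    ... | inj₂ Fj≤Fi = i , (λ x∈ → x∈) , Fj≤Fi

    base : ∀ {U} → U ≐ Subgroup.member S₀ → 𝒫′ U
    base U≐S₀ = isSubgroup S₀ U≐S₀ , base∈𝒫 _ U≐S₀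

    chain : ∀ {I : Set} → I → (F : I → Pred Carrier 0ℓ) → (∀ i → 𝒫′ (F i)) →
            (∀ i j → F i ⊆ F j ⊎ F j ⊆ F i) → ∀ {U} → U ≐ (λ x → ∃[ i ] x ∈ F i) → 𝒫′ U
    chain i F F∈𝒫 total U≐⋃ =
      isSubgroup (union G F′ i (directed F′ total)) U≐⋃ , chain∈𝒫 i F′ (proj₂ ∘ F∈𝒫) total _ U≐⋃
      where F′ = asSubgroup ∘ proj₁ ∘ F∈𝒫

  maximal-subgroup : ∃[ K ] 𝒫 K × (∀ K′ → 𝒫 K′ → K ≤ₛ K′ → K′ ≤ₛ K)
  maximal-subgroup with Zorn.maximal em fe 𝒫′ (Subgroup.member S₀) base chain
  ... | _ , (K-sub , K∈𝒫) , max = asSubgroup K-sub , K∈𝒫 , λ K′ K′∈𝒫 →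
    max (Subgroup.member K′) (isSubgroup K′ ((λ x∈ → x∈) , λ x∈ → x∈) , K′∈𝒫)

-- Torsionfree groups of rank one

module RankOne (T : AbelianGroup c ℓ) (torsionFree : TorsionFree T) where
  open AbelianGroup T
  open IntegerMultiples T
  open AbelianGroupSolver T
  open SetoidReasoning setoid

  private
    infix 4 _∈⟨_⟩ₜ

    _∈⟨_⟩ₜ : Carrier → Carrier → Set ℓ
    _∈⟨_⟩ₜ = _∈⟨_⟩ T

  ·-cancelˡ : ∀ n .{{_ : NonZero n}} {x y} → n · x ≈ n · y → x ≈ y
  ·-cancelˡ n {x} {y} nx≈ny =
    x∙y⁻¹≈ε⇒x≈y x y (torsionFree n (x - y) (trans (·-distrib-- n x y) (x≈y⇒x∙y⁻¹≈ε nx≈ny)))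

  ∈⟨⟩-trans : ∀ {x y z} → x ∈⟨ y ⟩ₜ → y ∈⟨ z ⟩ₜ → x ∈⟨ z ⟩ₜ
  ∈⟨⟩-trans {z = z} x∈y y∈z = ∈⟨⟩-least T (cyclic T z) y∈z x∈y

  -- The Euclidean algorithm carried out on a relation a x = b y.
  commensurable⇒cyclic : ∀ a b {x y} → 0 ℕ.< a ℕ.+ b → a · x ≈ b · y →
                         ∃[ z ] x ∈⟨ z ⟩ₜ × y ∈⟨ z ⟩ₜ
  commensurable⇒cyclic a b 0<a+b ax≈by = euclid (a ℕ.+ b) a b ℕ.≤-refl 0<a+b ax≈by
    where
    subtract : ∀ a c {x y} → a · x ≈ (a ℕ.+ c) · y → a · (x - y) ≈ c · y
    subtract a c {x} {y} ax≈by = begin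
      a · (x - y)                ≈⟨ ·-distrib-- a x y ⟩
      a · x - a · y              ≈⟨ ∙-congʳ (trans ax≈by (×-homo-+ y a c)) ⟩
      (a · y ∙ c · y) - a · y    ≈⟨ solve 2 (λ u v → (u ⊕ v ⊝ u) ⊜ v) refl _ _ ⟩
      c · y                      ∎

    restore : ∀ {x y z} → (x - y) ∈⟨ z ⟩ₜ → y ∈⟨ z ⟩ₜ → x ∈⟨ z ⟩ₜ
    restore {x} {y} {z} x-y∈ y∈ =
      Z.resp (solve 2 (λ x y → ((x ⊝ y) ⊕ y) ⊜ x) refl x y) (Z.∙-closed x-y∈ y∈)
      where module Z = Subgroup (cyclic T z)

    euclid : ∀ fuel a b {x y} → a ℕ.+ b ℕ.≤ fuel → 0 ℕ.< a ℕ.+ b → a · x ≈ b · y →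
             ∃[ z ] x ∈⟨ z ⟩ₜ × y ∈⟨ z ⟩ₜ
    euclid fuel zero (suc b) {x} {y} _ _ ε≈by =
      x , ∈⟨⟩-self T x , 0ℤ , torsionFree (suc b) y (sym ε≈by)
    euclid fuel (suc a) zero {x} {y} _ _ ax≈ε =
      y , (0ℤ , torsionFree (suc a) x ax≈ε) , ∈⟨⟩-self T y
    euclid (suc fuel) (suc a) (suc b) {x} {y} a+b≤fuel _ ax≈by with ℕ.≤-total a b
    ... | inj₁ a≤b with ℕ.m≤n⇒∃[o]m+o≡n a≤b
    ...   | c , ≡.refl =
      let z , x-y∈ , y∈ = euclid fuel (suc a) c {x - y} {y}
            (ℕ.≤-trans (ℕ.m≤n+m (suc (a ℕ.+ c)) a) (ℕ.s≤s⁻¹ a+b≤fuel))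
            (s≤s ℕ.z≤n) (subtract (suc a) c ax≈by)
      in z , restore x-y∈ y∈ , y∈
    euclid (suc fuel) (suc a) (suc b) {x} {y} a+b≤fuel _ ax≈by | inj₂ b≤a with ℕ.m≤n⇒∃[o]m+o≡n b≤a
    ...   | c , ≡.refl =
      let z , y-x∈ , x∈ = euclid fuel (suc b) c {y - x} {x}
            (ℕ.≤-trans (ℕ.m<m+n (b ℕ.+ c) (s≤s ℕ.z≤n)) (ℕ.s≤s⁻¹ a+b≤fuel))
            (s≤s ℕ.z≤n) (subtract (suc b) c (sym ax≈by))
      in z , x∈ , restore y-x∈ x∈

  -- A negative coefficient is absorbed by replacing the generator z with its inverse.
  positive-generator : ∀ {y z} → ¬ y ≈ ε → y ∈⟨ z ⟩ₜ → ∃[ n ] ∃[ z′ ] suc n · z′ ≈ y × z ∈⟨ z′ ⟩ₜ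
  positive-generator y≉ε (+ zero , y≈ε) = contradiction y≈ε y≉ε
  positive-generator {z = z} y≉ε (+ suc n , y≈nz) = n , z , sym y≈nz , ∈⟨⟩-self T z
  positive-generator {z = z} y≉ε (-[1+ n ] , y≈-nz) =
    n , z ⁻¹ , trans (·-⁻¹ (suc n) z) (sym y≈-nz) ,
    (-[1+ 0 ] , trans (sym (⁻¹-involutive z)) (⁻¹-cong (sym (identityʳ (z ⁻¹)))))

  -- The subgroups generated by the y n increase and exhaust a pure subgroup of rank one.
  record CyclicTower : Set (c ⊔ ℓ) where
    field
      y         : ℕ → Carrier
      d         : ℕ → ℕ
      d-nonZero : ∀ n → NonZero (d n)
      y-step    : ∀ n → d n · y (suc n) ≈ y n
      y≉ε       : ∀ n → ¬ y n ≈ ε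
      saturated : ∀ m .{{_ : NonZero m}} {w} n → m · w ∈⟨ y n ⟩ₜ → ∃[ k ] w ∈⟨ y k ⟩ₜ

  module _ (em : ∀ ℓ → ExcludedMiddle ℓ) {x : Carrier} (x≉ε : ¬ x ≈ ε) where

    private
      record Root : Set (c ⊔ ℓ) where
        constructor root
        field
          r     : Carrier
          m     : ℕ
          mr≈x  : suc m · r ≈ x

        r≉ε : ¬ r ≈ ε
        r≉ε r≈ε = x≉ε (trans (sym mr≈x) (trans (×-congʳ (suc m) r≈ε) (·-ε (suc m))))

      open Root

      -- Stage n passes to a cyclic group that contains the old root and also an (n+1)-th part of x,
      -- if x has one.
      record Refinement (n : ℕ) (R : Root) : Set (c ⊔ ℓ) where
        field
          R′     : Root
          e      : ℕ
          e-step : suc e · r R′ ≈ r R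
          covers : ∀ {w} → suc n · w ≈ x → w ∈⟨ r R′ ⟩ₜ

      refine : ∀ n R → Refinement n R
      refine n R@(root r m mr≈x) with em _ {∃[ w ] suc n · w ≈ x}
      ... | no ∄w = record
        { R′ = R ; e = 0 ; e-step = identityʳ r
        ; covers = λ nw≈x → contradiction (_ , nw≈x) ∄w }
      ... | yes (w , nw≈x)
        with commensurable⇒cyclic (suc n) (suc m) (s≤s ℕ.z≤n) (trans nw≈x (sym mr≈x))
      ...   | z , w∈z , r∈z with positive-generator (r≉ε R) r∈z
      ...     | e , z′ , ez′≈r , z∈z′ = record
        -- The successor of this number is `suc m ℕ.* suc e` by definition.
        { R′ = root z′ (e ℕ.+ m ℕ.* suc e)
                 (trans (sym (×-assocˡ z′ (suc m) (suc e))) (trans (×-congʳ (suc m) ez′≈r) mr≈x))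
        ; e = e ; e-step = ez′≈r
        -- In a torsionfree group the (n+1)-th part of x is unique, so absorbing the single w
        -- suffices.
        ; covers = λ nw′≈x → Subgroup.resp (cyclic T z′)
            (·-cancelˡ (suc n) (trans nw≈x (sym nw′≈x))) (∈⟨⟩-trans w∈z z∈z′)
        }

      module Refined (n : ℕ) (R : Root) = Refinement (refine n R)

      roots : ℕ → Root
      roots zero    = root x 0 (identityʳ x)
      roots (suc n) = Refined.R′ n (roots n)

      -- Some positive multiple of w is a multiple of x, so w and x lie in a common cyclic group.
      -- Its generator can be taken to be an (n+1)-th part of x, for some n, and stage n has put
      -- that part into the group of root n+1.
      roots-saturated : ∀ m .{{_ : NonZero m}} {w} n → m · w ∈⟨ r (roots n) ⟩ₜ →
                        ∃[ k ] w ∈⟨ r (roots k) ⟩ₜ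
      roots-saturated m {w} n (i , mw≈iy) = by-sign i multiple-of-x
        where
        N M : ℕ
        N = suc (Root.m (roots n))
        M = N ℕ.* m

        0<M : 0 ℕ.< M
        0<M = ℕ.≤-trans (ℕ.>-nonZero⁻¹ m) (ℕ.m≤m+n m _)

        multiple-of-x : M · w ≈ i ⋆ x
        multiple-of-x = begin
          M · w                  ≈⟨ ×-assocˡ w N m ⟨
          N · m · w              ≈⟨ ×-congʳ N mw≈iy ⟩
          N · i ⋆ r (roots n)    ≈⟨ ·-⋆-comm N i (r (roots n)) ⟩
          i ⋆ N · r (roots n)    ≈⟨ ⋆-congʳ i (mr≈x (roots n)) ⟩
          i ⋆ x                  ∎

        common : ∀ {z} → w ∈⟨ z ⟩ₜ → x ∈⟨ z ⟩ₜ → ∃[ k ] w ∈⟨ r (roots k) ⟩ₜ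
        common w∈z x∈z = let n , z′ , nz′≈x , z∈z′ = positive-generator x≉ε x∈z in
          suc n , ∈⟨⟩-trans w∈z (∈⟨⟩-trans z∈z′ (Refined.covers n (roots n) nz′≈x))

        by-sign : ∀ i → M · w ≈ i ⋆ x → ∃[ k ] w ∈⟨ r (roots k) ⟩ₜ
        by-sign (+ k) Mw≈kx =
          let z , w∈z , x∈z = commensurable⇒cyclic M k (ℕ.≤-trans 0<M (ℕ.m≤m+n M k)) Mw≈kx
          in common w∈z x∈z
        by-sign (-[1+ k ]) Mw≈-kx =
          let z , w⁻¹∈z , x∈z = commensurable⇒cyclic M (suc k) (ℕ.≤-trans 0<M (ℕ.m≤m+n M (suc k)))
                (trans (·-⁻¹ M w) (trans (⁻¹-cong Mw≈-kx) (⁻¹-involutive _)))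
          in common (Subgroup.resp (cyclic T z) (⁻¹-involutive w)
               (Subgroup.⁻¹-closed (cyclic T z) w⁻¹∈z)) x∈z

    cyclicTower : CyclicTower
    cyclicTower = record
      { y         = λ n → r (roots n)
      ; d         = λ n → suc (Refined.e n (roots n))
      ; d-nonZero = λ n → _
      ; y-step    = λ n → Refined.e-step n (roots n)
      ; y≉ε       = λ n → r≉ε (roots n)
      ; saturated = roots-saturated
      }

-- Splitting extensions

prime∤⇒coprime : ∀ {m n} → Prime m → ¬ m ∣ n → Coprime m n
prime∤⇒coprime m-prime m∤n (d∣m , d∣n) with prime⇒irreducible m-prime d∣m
... | inj₁ d≡1    = d≡1
... | inj₂ ≡.refl = contradiction d∣n m∤n

-- Let J be generated by y n with d n · y (n+1) = y n. If lifts of the y n to an extension satisfy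
-- these relations up to errors a n in G, then subtracting g n from the n-th lift removes the errors
-- exactly when g solves the system.
TowerSolvable : AbelianGroup c ℓ → Set (c ⊔ ℓ)
TowerSolvable G =
  ∀ (d : ℕ → ℕ) → (∀ n → NonZero (d n)) → (a : ℕ → Carrier) →
  Σ[ g ∈ (ℕ → Carrier) ] ∀ n → d n · g (suc n) ≈ g n ∙ a n
  where
  open AbelianGroup G
  open IntegerMultiples G using (_·_)

module Splitting {J G : AbelianGroup 0ℓ 0ℓ} (X : Extension J G) where
  private
    module G  = AbelianGroup G
    module J  = AbelianGroup J
    module MG = IntegerMultiples G
    module MJ = IntegerMultiples J
  open Extension X using (E; inj; proj; inj-mono; proj-homo; proj-surjective; exact)
  open AbelianGroup E
  open IntegerMultiples E
  open AbelianGroupSolver E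

  module ι = Homomorphism {G = G} {H = E} {f = inj}
    (IsGroupMonomorphism.isGroupHomomorphism inj-mono)
  module π = Homomorphism {G = E} {H = J} {f = proj} proj-homo

  inj-injective-ε : ∀ {g} → inj g ≈ ε → g G.≈ G.ε
  inj-injective-ε inj-g≈ε = IsGroupMonomorphism.injective inj-mono (trans inj-g≈ε (sym ι.ε-homo))

  proj-inj : ∀ g → proj (inj g) J.≈ J.ε
  proj-inj g = Equivalence.from (exact (inj g)) (g , refl)

  ker-proj : ∀ {e} → proj e J.≈ J.ε → ∃[ g ] inj g ≈ e
  ker-proj {e} = Equivalence.to (exact e)

  MeetsTrivially : Subgroup E 0ℓ → Set
  MeetsTrivially K = ∀ {g} → inj g ∈ Subgroup.member K → g G.≈ G.ε

  _+G : Subgroup E 0ℓ → Subgroup E 0ℓ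
  K +G = record
    { member    = λ e → ∃[ g ] (e - inj g) ∈ K.member
    ; resp      = λ e≈e′ (g , e-g∈K) → g , K.resp (∙-congʳ e≈e′) e-g∈K
    ; ε-closed  = G.ε , K.resp (sym (trans (∙-congˡ (⁻¹-cong ι.ε-homo)) ε-ε≈ε)) K.ε-closed
    ; ∙-closed  = λ {e} {e′} (g , e-g∈K) (g′ , e′-g′∈K) → g G.∙ g′ , K.resp
        (trans (-‿∙-interchange e (inj g) e′ (inj g′)) (∙-congˡ (⁻¹-cong (sym (ι.homo g g′)))))
        (K.∙-closed e-g∈K e′-g′∈K)
    ; ⁻¹-closed = λ {e} (g , e-g∈K) → g G.⁻¹ , K.resp
        (trans (sym (⁻¹-∙-comm e (inj g ⁻¹))) (∙-congˡ (⁻¹-cong (sym (ι.⁻¹-homo g)))))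
        (K.⁻¹-closed e-g∈K)
    }
    where module K = Subgroup K

  ≤+G : ∀ K → K ≤ₛ K +G
  ≤+G K {e} e∈K = G.ε , Subgroup.resp K
    (sym (trans (∙-congˡ (trans (⁻¹-cong ι.ε-homo) ε⁻¹≈ε)) (identityʳ e))) e∈K

  inj∈+G : ∀ K g → inj g ∈ Subgroup.member (K +G)
  inj∈+G K g = g , Subgroup.resp K (sym (inverseʳ (inj g))) (Subgroup.ε-closed K)

  +G-mono : ∀ K K′ → K ≤ₛ K′ → K +G ≤ₛ K′ +G
  +G-mono K K′ K≤K′ (g , e-g∈K) = g , K≤K′ e-g∈K

  module _ (K : Subgroup E 0ℓ) (K∩G≈0 : MeetsTrivially K)
           (spans : ∀ e → e ∈ Subgroup.member (K +G)) where
    private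
      module K = Subgroup K

      -- The difference of g and g′ lies in K and in G. This makes `component` well defined, and
      -- additive because any decomposition of a sum may be used to compute it.
      component-unique : ∀ {e e′ g g′} → e ≈ e′ → (e - inj g) ∈ K.member →
                         (e′ - inj g′) ∈ K.member → g G.≈ g′
      component-unique {e} {e′} {g} {g′} e≈e′ e-g∈K e′-g′∈K =
        MG.x∙y⁻¹≈ε⇒x≈y g g′ (K∩G≈0 (K.resp
          (trans (∙-congˡ (⁻¹-cong (∙-congʳ e≈e′)))
            (trans (solve 3 (λ e′ u v → ((e′ ⊝ v) ⊝ (e′ ⊝ u)) ⊜ (u ⊝ v)) refl e′ (inj g) (inj g′))
              (sym (ι.-‿homo g g′))))
          (K.∙-closed e′-g′∈K (K.⁻¹-closed e-g∈K))))

      component : Carrier → G.Carrier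
      component e = proj₁ (spans e)

      component-eq : ∀ e {g} → (e - inj g) ∈ K.member → component e G.≈ g
      component-eq e e-g∈K = component-unique refl (proj₂ (spans e)) e-g∈K

      component-cong : ∀ {e e′} → e ≈ e′ → component e G.≈ component e′
      component-cong {e} {e′} e≈e′ = component-unique e≈e′ (proj₂ (spans e)) (proj₂ (spans e′))

      -- Equal components put the difference of e and e′ in K, equal projections put it in G.
      decompose : ∀ {e e′} → component e G.≈ component e′ → proj e J.≈ proj e′ → e ≈ e′
      decompose {e} {e′} g≈g′ j≈j′ =
        let h , h≈ = ker-proj (J.trans (π.-‿homo e e′) (MJ.x≈y⇒x∙y⁻¹≈ε j≈j′)) in
        x∙y⁻¹≈ε⇒x≈y e e′
          (trans (sym h≈) (trans (ι.⟦⟧-cong (K∩G≈0 (K.resp (sym h≈) difference∈K))) ι.ε-homo))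
        where
        difference∈K : (e - e′) ∈ K.member
        difference∈K = K.resp
          (trans (∙-congʳ (∙-congˡ (⁻¹-cong (ι.⟦⟧-cong g≈g′))))
            (solve 3 (λ e e′ u → ((e ⊝ u) ⊝ (e′ ⊝ u)) ⊜ (e ⊝ e′)) refl e e′ (inj (component e′))))
          (K.∙-closed (proj₂ (spans e)) (K.⁻¹-closed (proj₂ (spans e′))))

      lift : J.Carrier → Carrier
      lift j = proj₁ (proj-surjective j)

      -- Removing the G-component from a lift of j leaves an element of K above j.
      recompose : G.Carrier → J.Carrier → Carrier
      recompose g j = (lift j - inj (component (lift j))) ∙ inj g

      component-recompose : ∀ g j → component (recompose g j) G.≈ g
      component-recompose g j = component-eq (recompose g j)
        (K.resp (solve 2 (λ k u → k ⊜ ((k ⊕ u) ⊝ u)) refl _ (inj g)) (proj₂ (spans (lift j))))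

      proj-recompose : ∀ g j → proj (recompose g j) J.≈ j
      proj-recompose g j = begin
        proj (recompose g j)
          ≈⟨ π.homo _ (inj g) ⟩
        proj (lift j - inj h) J.∙ proj (inj g)
          ≈⟨ J.∙-cong (π.-‿homo (lift j) (inj h)) (proj-inj g) ⟩
        (proj (lift j) J.- proj (inj h)) J.∙ J.ε
          ≈⟨ J.identityʳ _ ⟩
        proj (lift j) J.- proj (inj h)
          ≈⟨ J.∙-cong (proj₂ (proj-surjective j) refl) (J.⁻¹-cong (proj-inj h)) ⟩
        j J.- J.ε
          ≈⟨ J.∙-congˡ MJ.ε⁻¹≈ε ⟩
        j J.∙ J.ε
          ≈⟨ J.identityʳ j ⟩
        j ∎
        where
        open SetoidReasoning J.setoid
        h = component (lift j)

    complement⇒split : Equivalent X (splitExtension J G)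
    complement⇒split = record
      { φ      = λ e → component e , proj e
      ; φ-iso  = record
        { isGroupMonomorphism = record
          { isGroupHomomorphism = record
            { isMonoidHomomorphism = record
              { isMagmaHomomorphism = record
                { isRelHomomorphism = record
                  { cong = λ e≈e′ → component-cong e≈e′ , π.⟦⟧-cong e≈e′ }
                ; homo = λ e e′ →
                    component-eq (e ∙ e′) (proj₂ (Subgroup.∙-closed (K +G) (spans e) (spans e′))) ,
                    π.homo e e′
                }
              ; ε-homo = component-eq ε (proj₂ (Subgroup.ε-closed (K +G))) , π.ε-homo
              }
            ; ⁻¹-homo = λ e →
                component-eq (e ⁻¹) (proj₂ (Subgroup.⁻¹-closed (K +G) (spans e))) , π.⁻¹-homo e
            }
          ; injective = λ (g≈g′ , j≈j′) → decompose g≈g′ j≈j′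
          }
        ; surjective = λ (g , j) → recompose g j , λ e≈ →
            G.trans (component-cong e≈) (component-recompose g j) ,
            J.trans (π.⟦⟧-cong e≈) (proj-recompose g j)
        }
      ; φ-inj  = λ g → component-eq (inj g) (proj₂ (inj∈+G K g)) , proj-inj g
      ; φ-proj = λ e → J.refl
      }

-- Complements from maximal subgroups

module _ (em : ∀ ℓ → ExcludedMiddle ℓ) (fe : ∀ a b → Extensionality a b) where
  open Classical em

  module _ {J G : AbelianGroup 0ℓ 0ℓ} (J-torsionFree : TorsionFree J) (X : Extension J G) where
    private
      module G  = AbelianGroup G
      module J  = AbelianGroup J
      module MG = IntegerMultiples G
    open Extension X using (E; inj; proj)
    open AbelianGroup E
    open IntegerMultiples E
    open AbelianGroupSolver E
    open Splitting X

    private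
      infix 4 _∈ₛ_
      _∈ₛ_ : Carrier → Subgroup E 0ℓ → Set
      e ∈ₛ S = e ∈ Subgroup.member S

      -- K + ⟨z⟩, taken as a preimage from E / K so that the lemmas on cyclic subgroups apply.
      adjoin : (K : Subgroup E 0ℓ) → Carrier → Subgroup E 0ℓ
      adjoin K z =
        Homomorphism.preimage {G = E} {H = quotient E K} (quotient-homo E K)
          (cyclic (quotient E K) z)

      module _ (K : Subgroup E 0ℓ) where

        ≤adjoin : ∀ z → K ≤ₛ adjoin K z
        ≤adjoin z x∈K = 0ℤ , ∈⇒∼ε E K x∈K

        adjoined : ∀ z → z ∈ₛ adjoin K z
        adjoined z = ∈⟨⟩-self (quotient E K) z

        adjoin-least : ∀ S → K ≤ₛ S → ∀ {z} → z ∈ₛ S → adjoin K z ≤ₛ S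
        adjoin-least S K≤S z∈S = ∈⟨⟩-least (quotient E K) (image E K S K≤S) z∈S

        quotient-torsionFree : (∀ n .{{_ : NonZero n}} x → n · x ∈ₛ K → x ∈ₛ K) →
                               TorsionFree (quotient E K)
        quotient-torsionFree pure n x nx∼ε = ∈⇒∼ε E K
          (pure n x (∼ε⇒∈ E K (AbelianGroup.trans (quotient E K) (quotient-· E K n x) nx∼ε)))

    -- This says that E / (K + G) is torsionfree.
    Pure+G : Subgroup E 0ℓ → Set
    Pure+G K = ∀ n .{{_ : NonZero n}} e → n · e ∈ₛ K +G → e ∈ₛ K +G

    module TowerStep (G-solvable : TowerSolvable G) (K : Subgroup E 0ℓ)
                     (K∩G≈0 : MeetsTrivially K) (K+G-pure : Pure+G K)
                     {x : Carrier} (x∉K+G : ¬ x ∈ₛ K +G) where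
      private
        K+G = K +G
        Q   = quotient E K+G
        module Q  = AbelianGroup Q
        module MQ = IntegerMultiples Q
        module R  = RankOne Q (quotient-torsionFree K+G K+G-pure)
        module MK = IntegerMultiples (quotient E K)
        module KG = Subgroups K+G

        tower : R.CyclicTower
        tower = R.cyclicTower em λ x∼ε → x∉K+G (∼ε⇒∈ E K+G x∼ε)

      open R.CyclicTower tower

      defect : ∀ n → (d n · y (suc n) - y n) ∈ₛ K+G
      defect n = Q.trans (quotient-· E K+G (d n) (y (suc n))) (y-step n)

      private
        -- The relations between the y n hold modulo K + G. The G-components of their errors form
        -- the system, and its solution yields z n for which the relations hold modulo K alone.
        solution = G-solvable d d-nonZero (proj₁ ∘ defect)
        g        = proj₁ solution

      z : ℕ → Carrier
      z n = y n - inj (g n)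

      z-step : ∀ n → (d n · z (suc n) - z n) ∈ₛ K
      z-step n = Subgroup.resp K (sym (begin
        d n · z (suc n) - z n
          ≈⟨ ∙-congʳ (·-distrib-- (d n) (y (suc n)) (inj (g (suc n)))) ⟩
        (d n · y (suc n) - d n · inj (g (suc n))) - z n
          ≈⟨ ∙-congʳ (∙-congˡ (⁻¹-cong (trans (sym (ι.·-homo (d n) (g (suc n))))
               (trans (ι.⟦⟧-cong (proj₂ solution n)) (ι.homo (g n) (proj₁ (defect n))))))) ⟩
        (d n · y (suc n) - (inj (g n) ∙ inj (proj₁ (defect n)))) - z n
          ≈⟨ solve 4 (λ dy u v yn → ((dy ⊝ (u ⊕ v)) ⊝ (yn ⊝ u)) ⊜ ((dy ⊝ yn) ⊝ v)) refl
               (d n · y (suc n)) (inj (g n)) (inj (proj₁ (defect n))) (y n) ⟩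
        (d n · y (suc n) - y n) - inj (proj₁ (defect n)) ∎)) (proj₂ (defect n))
        where open SetoidReasoning setoid

      layer : ℕ → Subgroup E 0ℓ
      layer n = adjoin K (z n)

      layer-step : ∀ n → layer n ≤ₛ layer (suc n)
      layer-step n = adjoin-least K L (≤adjoin K (z (suc n))) (L.resp
        (solve 2 (λ u v → (u ⊝ (u ⊝ v)) ⊜ v) refl (d n · z (suc n)) (z n))
        (L.-‿closed (L.·-closed (d n) (adjoined K (z (suc n)))) (≤adjoin K (z (suc n)) (z-step n))))
        where
        L = layer (suc n)
        module L = Subgroups L

      layer-mono : ∀ {m n} → m ℕ.≤′ n → layer m ≤ₛ layer n
      layer-mono ℕ.≤′-refl       x∈ = x∈
      layer-mono (ℕ.≤′-step m≤n) x∈ = layer-step _ (layer-mono m≤n x∈)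

      enlarged : Subgroup E 0ℓ
      enlarged = union E layer 0 λ m n → m ℕ.⊔ n ,
        layer-mono (ℕ.≤⇒≤′ (ℕ.m≤m⊔n m n)) , layer-mono (ℕ.≤⇒≤′ (ℕ.m≤n⊔m m n))

      ≤enlarged : K ≤ₛ enlarged
      ≤enlarged e∈K = 0 , ≤adjoin K (z 0) e∈K

      y-z : ∀ n → (y n - z n) ∈ₛ K+G
      y-z n = KG.resp
        (solve 2 (λ y u → u ⊜ (y ⊝ (y ⊝ u))) refl (y n) (inj (g n)))
        (inj∈+G K (g n))

      y∈layer+G : ∀ n → y n ∈ₛ layer n +G
      y∈layer+G n = g n , adjoined K (z n)

      layer≤adjoin-y : ∀ n → layer n ≤ₛ adjoin K+G (y n)
      layer≤adjoin-y n = adjoin-least K S (λ e∈K → ≤adjoin K+G (y n) (≤+G K e∈K)) (Subgroup.resp S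
        (solve 2 (λ u v → (u ⊝ (u ⊝ v)) ⊜ v) refl (y n) (z n))
        (Subgroups.-‿closed S (adjoined K+G (y n)) (≤adjoin K+G (y n) (y-z n))))
        where S = adjoin K+G (y n)

      layer≤enlarged : ∀ n → layer n ≤ₛ enlarged
      layer≤enlarged n e∈ = n , e∈

      multiple∈ : ∀ m e {h} n → (m · e - inj h) ∈ₛ layer n → (m MQ.· e) ∈ₛ adjoin K+G (y n)
      multiple∈ m e {h} n me-h∈ = S.resp
        (solve 3 (λ u v w → (((u ⊝ v) ⊕ v) ⊝ (u ⊝ w)) ⊜ w) refl (m · e) (inj h) (m MQ.· e))
        (S.-‿closed (S.∙-closed (layer≤adjoin-y n me-h∈) (≤adjoin K+G (y n) (inj∈+G K h)))
                    (≤adjoin K+G (y n) (quotient-· E K+G m e)))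
        where module S = Subgroups (adjoin K+G (y n))

      adjoin-y≤layer+G : ∀ n → adjoin K+G (y n) ≤ₛ layer n +G
      adjoin-y≤layer+G n =
        adjoin-least K+G (layer n +G) (+G-mono K (layer n) (≤adjoin K (z n))) (y∈layer+G n)

      -- As y n and z n agree modulo K + G, `layer n +G` is the preimage of the cyclic group of y n
      -- in E / (K + G). Purity is thus the saturation of the tower.
      enlarged+G-pure : Pure+G enlarged
      enlarged+G-pure m e (h , n , me-h∈) =
        let k , e∈ = saturated m {w = e} n (multiple∈ m e n me-h∈) in
        +G-mono (layer k) enlarged (layer≤enlarged k) (adjoin-y≤layer+G k e∈)

      -- By purity z n itself would lie in K + G, and so would y n, which is nonzero modulo K + G.
      z-independent : ∀ m n → ¬ (suc m MK.· z n) ∈ₛ K+G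
      z-independent m n mz∈ = y≉ε n (∈⇒∼ε E K+G (KG.resp
        (solve 2 (λ y z → ((y ⊝ z) ⊕ z) ⊜ y) refl (y n) (z n))
        (KG.∙-closed (y-z n) (K+G-pure (suc m) (z n) (KG.resp
          (solve 2 (λ u v → ((u ⊝ v) ⊕ v) ⊜ u) refl (suc m · z n) (suc m MK.· z n))
          (KG.∙-closed (≤+G K (quotient-· E K (suc m) (z n))) mz∈))))))

      inj∼multiple : ∀ {h e} → (inj h - e) ∈ₛ K → e ∈ₛ K+G
      inj∼multiple {h} {e} h∼e = Subgroup.resp (image E K K+G (≤+G K)) {inj h} {e} h∼e (inj∈+G K h)

      -- By `z-independent` only the coefficient 0 can occur, and then h lies in K.
      multiple∩G≈0 : ∀ n i {h} → (inj h - i MK.⋆ z n) ∈ₛ K → h G.≈ G.ε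
      multiple∩G≈0 n (+ 0)      {h} h∼0   = K∩G≈0 {h} (∼ε⇒∈ E K h∼0)
      multiple∩G≈0 n (+ suc m)  {h} h∼mz  =
        contradiction (inj∼multiple {h} {suc m MK.· z n} h∼mz) (z-independent m n)
      multiple∩G≈0 n (-[1+ m ]) {h} h∼-mz = contradiction
        (KG.resp (⁻¹-involutive (suc m MK.· z n))
          (KG.⁻¹-closed (inj∼multiple {h} {(suc m MK.· z n) ⁻¹} h∼-mz)))
        (z-independent m n)

      enlarged∩G≈0 : MeetsTrivially enlarged
      enlarged∩G≈0 {h} (n , i , h∼iz) = multiple∩G≈0 n i {h} h∼iz

      -- Otherwise z 0 would lie in K, hence y 0 in K + G.
      enlarged≰K : ¬ enlarged ≤ₛ K
      enlarged≰K ≤K = y≉ε 0 (∈⇒∼ε E K+G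
        (+G-mono (layer 0) K (λ e∈ → ≤K (layer≤enlarged 0 e∈)) (y∈layer+G 0)))

    trivial : Subgroup E 0ℓ
    trivial = record
      { member    = λ e → e ≈ ε
      ; resp      = λ x≈y x≈ε → trans (sym x≈y) x≈ε
      ; ε-closed  = refl
      ; ∙-closed  = λ x≈ε y≈ε → trans (∙-cong x≈ε y≈ε) (identityˡ ε)
      ; ⁻¹-closed = λ x≈ε → trans (⁻¹-cong x≈ε) ε⁻¹≈ε
      }

    private
      _≈ₛ_ : Subgroup E 0ℓ → Pred Carrier 0ℓ → Set
      S ≈ₛ P = Subgroup.member S ≐ P

    MeetsTriviallyPurely : Subgroup E 0ℓ → Set
    MeetsTriviallyPurely K = MeetsTrivially K × Pure+G K

    -- E / G is J, so purity for the zero subgroup is torsionfreeness of J.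
    trivial-meetsTriviallyPurely : ∀ S → S ≈ₛ (_≈ ε) → MeetsTriviallyPurely S
    trivial-meetsTriviallyPurely S (S⊆0 , 0⊆S) = meets , pure
      where
      meets : MeetsTrivially S
      meets h∈S = inj-injective-ε (S⊆0 h∈S)

      pure : Pure+G S
      pure n e (g , ne-g∈S) =
        let proj-e≈ε = J-torsionFree n (proj e) (J.trans (J.sym (π.·-homo n e))
              (J.trans (π.⟦⟧-cong (x∙y⁻¹≈ε⇒x≈y (n · e) (inj g) (S⊆0 ne-g∈S))) (proj-inj g)))
            h , h≈e = ker-proj proj-e≈ε
        in h , 0⊆S (x≈y⇒x∙y⁻¹≈ε (sym h≈e))

    module _ {I : Set} (F : I → Subgroup E 0ℓ) (S : Subgroup E 0ℓ)
             (S≈⋃F : S ≈ₛ (λ e → ∃[ i ] e ∈ₛ F i)) where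

      ⋃-meetsTrivially : (∀ i → MeetsTrivially (F i)) → MeetsTrivially S
      ⋃-meetsTrivially F-meets {h} h∈S = let i , h∈Fi = proj₁ S≈⋃F h∈S in F-meets i {h} h∈Fi

      ⋃-pure+G : (∀ i → Pure+G (F i)) → Pure+G S
      ⋃-pure+G F-pure n e (g , ne-g∈S) =
        let i , ne-g∈Fi = proj₁ S≈⋃F ne-g∈S
            h , e-h∈Fi = F-pure i n e (g , ne-g∈Fi)
        in h , proj₂ S≈⋃F (i , e-h∈Fi)

    module _ (G-solvable : TowerSolvable G) where
      private
        maximal-K : ∃[ K ] MeetsTriviallyPurely K ×
                           (∀ K′ → MeetsTriviallyPurely K′ → K ≤ₛ K′ → K′ ≤ₛ K)
        maximal-K = SubgroupZorn.maximal-subgroup em fe E MeetsTriviallyPurely trivial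
          trivial-meetsTriviallyPurely
          (λ _ F F∈𝒫 _ S S≈⋃F →
            ⋃-meetsTrivially F S S≈⋃F (proj₁ ∘ F∈𝒫) , ⋃-pure+G F S S≈⋃F (proj₂ ∘ F∈𝒫))

        K = proj₁ maximal-K
        K∩G≈0 : MeetsTrivially K
        K∩G≈0 = proj₁ (proj₁ (proj₂ maximal-K))

        module Enlargement {e} (e∉K+G : ¬ e ∈ₛ K +G) =
          TowerStep G-solvable K K∩G≈0 (proj₂ (proj₁ (proj₂ maximal-K))) e∉K+G

        K-spans : ∀ e → e ∈ₛ K +G
        K-spans e = by-contradiction λ e∉K+G → Enlargement.enlarged≰K e∉K+G
          (proj₂ (proj₂ maximal-K) (Enlargement.enlarged e∉K+G)
            (Enlargement.enlarged∩G≈0 e∉K+G , Enlargement.enlarged+G-pure e∉K+G)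
            (Enlargement.≤enlarged e∉K+G))

      towerSolvable⇒split : Equivalent X (splitExtension J G)
      towerSolvable⇒split = complement⇒split K K∩G≈0 K-spans

    module _ (p : ℕ) (p-prime : Prime p) (pG≈0 : ∀ g → p MG.· g G.≈ G.ε) where
      private
        instance p-nonZero = prime⇒nonZero p-prime

      multiples : Subgroup E 0ℓ
      multiples = record
        { member    = λ e → ∃[ e′ ] p · e′ ≈ e
        ; resp      = λ x≈y (e′ , pe′≈x) → e′ , trans pe′≈x x≈y
        ; ε-closed  = ε , ·-ε p
        ; ∙-closed  = λ (e , pe≈x) (f , pf≈y) → e ∙ f , trans (×-distrib-+ e f p) (∙-cong pe≈x pf≈y)
        ; ⁻¹-closed = λ (e , pe≈x) → e ⁻¹ , trans (·-⁻¹ p e) (⁻¹-cong pe≈x)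
        }

      -- If p e lies in G, so does e, because J is torsionfree; and p annihilates G.
      multiples∩G≈0 : MeetsTrivially multiples
      multiples∩G≈0 {h} (e , pe≈h) =
        let g , g≈e = ker-proj (J-torsionFree p (proj e)
              (J.trans (J.sym (π.·-homo p e)) (J.trans (π.⟦⟧-cong pe≈h) (proj-inj h))))
        in inj-injective-ε (trans (sym pe≈h) (trans (×-congʳ p (sym g≈e))
             (trans (sym (ι.·-homo p g)) (trans (ι.⟦⟧-cong (pG≈0 g)) ι.ε-homo))))

      -- Let h be congruent to i x modulo K. If p divides i, then i x is in K and h is in K and G.
      -- Otherwise i x and p x both lie in K + G with i and p coprime, which would put x there.
      adjoin∩G≈0 : ∀ K → MeetsTrivially K → (∀ e → p · e ∈ₛ K) →
                   ∀ {x} → ¬ x ∈ₛ K +G → MeetsTrivially (adjoin K x)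
      adjoin∩G≈0 K K∩G≈0 pE≤K {x} x∉K+G {h} (i , h∼ix) = by-divisibility (p ∣? ℤ.∣ i ∣)
        where
        module MK  = IntegerMultiples (quotient E K)
        module K/K = Subgroups (image E K K (λ {x} x∈ → x∈))
        module KG  = Subgroups (K +G)
        module KG/K = Subgroups (image E K (K +G) (≤+G K))

        by-divisibility : Dec (p ∣ ℤ.∣ i ∣) → h G.≈ G.ε
        by-divisibility (yes p∣i) = K∩G≈0 {h} (K/K.resp {i MK.⋆ x} {inj h}
          (AbelianGroup.sym (quotient E K) {inj h} {i MK.⋆ x} h∼ix)
          (K/K.∣⋆∣-closed⁻ i (K/K.∣·-closed p∣i (K/K.resp (quotient-· E K p x) (pE≤K x)))))
        by-divisibility (no p∤i) = contradiction
          (KG.coprime-closed (prime∤⇒coprime p-prime p∤i) (≤+G K (pE≤K x))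
            (KG/K.resp (AbelianGroup.sym (quotient E K) (quotient-· E K ℤ.∣ i ∣ x))
              (KG/K.∣⋆∣-closed i (KG/K.resp {inj h} {i MK.⋆ x} h∼ix (inj∈+G K h)))))
          x∉K+G

      ContainsMultiples : Subgroup E 0ℓ → Set
      ContainsMultiples K = ∀ e → p · e ∈ₛ K

      private
        𝒫 : Subgroup E 0ℓ → Set
        𝒫 K = MeetsTrivially K × ContainsMultiples K

        multiples∈𝒫 : ∀ S → S ≈ₛ Subgroup.member multiples → 𝒫 S
        multiples∈𝒫 S (S⊆pE , pE⊆S) =
          (λ {h} h∈S → multiples∩G≈0 {h} (S⊆pE h∈S)) , λ e → pE⊆S (e , refl)

        maximal-K : ∃[ K ] 𝒫 K × (∀ K′ → 𝒫 K′ → K ≤ₛ K′ → K′ ≤ₛ K)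
        maximal-K = SubgroupZorn.maximal-subgroup em fe E 𝒫 multiples multiples∈𝒫
          (λ i F F∈𝒫 _ S S≈⋃F →
            ⋃-meetsTrivially F S S≈⋃F (proj₁ ∘ F∈𝒫) , λ e → proj₂ S≈⋃F (i , proj₂ (F∈𝒫 i) e))

        K = proj₁ maximal-K
        K∩G≈0 : MeetsTrivially K
        K∩G≈0 = proj₁ (proj₁ (proj₂ maximal-K))
        pE≤K : ContainsMultiples K
        pE≤K = proj₂ (proj₁ (proj₂ maximal-K))

        K-spans : ∀ x → x ∈ₛ K +G
        K-spans x = by-contradiction λ x∉K+G → x∉K+G (≤+G K
          (proj₂ (proj₂ maximal-K) (adjoin K x)
            (adjoin∩G≈0 K K∩G≈0 pE≤K x∉K+G , λ e → ≤adjoin K x (pE≤K e))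
            (≤adjoin K x) (adjoined K x)))

      -- A subgroup that is maximal among those containing p E and meeting G trivially is a
      -- complement of G.
      elementary⇒split : Equivalent X (splitExtension J G)
      elementary⇒split = complement⇒split K K∩G≈0 K-spans

  towerSolvable⇒cotorsion : ∀ {G} → TowerSolvable G → Cotorsion G
  towerSolvable⇒cotorsion G-solvable J J-torsionFree X =
    towerSolvable⇒split J-torsionFree X G-solvable

  module _ {G : AbelianGroup 0ℓ 0ℓ} where
    open AbelianGroup G
    open IntegerMultiples G

    elementary⇒cotorsion : ∀ p → Prime p → (∀ g → p · g ≈ ε) → Cotorsion G
    elementary⇒cotorsion p p-prime pG≈0 J J-torsionFree X =
      elementary⇒split J-torsionFree X p p-prime pG≈0

-- Cotorsionfree groups

Divisible : AbelianGroup c ℓ → Set (c ⊔ ℓ)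
Divisible G = ∀ n .{{_ : NonZero n}} x → ∃[ y ] n · y ≈ x
  where
  open AbelianGroup G
  open IntegerMultiples G using (_·_)

divisible⇒towerSolvable : (G : AbelianGroup c ℓ) → Divisible G → TowerSolvable G
divisible⇒towerSolvable G divide d d-nonZero a = g , λ n → proj₂ (next n)
  where
  open AbelianGroup G
  open IntegerMultiples G using (_·_)
  g : ℕ → Carrier
  next : ∀ n → ∃[ y ] d n · y ≈ g n ∙ a n
  g zero    = ε
  g (suc n) = proj₁ (next n)
  next n = divide (d n) {{d-nonZero n}} (g n ∙ a n)

module _ (G : AbelianGroup c ℓ) (H : Subgroup G p) where
  private module MH = IntegerMultiples (subgroup G H)
  open AbelianGroup G
  open IntegerMultiples G

  subgroup-· : ∀ n h → proj₁ (n MH.· h) ≈ n · proj₁ h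
  subgroup-· = Homomorphism.·-homo {G = subgroup G H} {H = G} {f = proj₁}
    (IsGroupMonomorphism.isGroupHomomorphism (inclusion-isGroupMonomorphism G H))

module _ (G : AbelianGroup c ℓ) where
  open AbelianGroup G
  open IntegerMultiples G

  -- `CotorsionFree` speaks about subgroups only, so G has to be presented as one of its own.
  whole : Subgroup G 0ℓ
  whole = record
    { member = λ _ → ⊤ ; resp = λ _ _ → tt ; ε-closed = tt
    ; ∙-closed = λ _ _ → tt ; ⁻¹-closed = λ _ → tt }

  whole-towerSolvable : TowerSolvable G → TowerSolvable (subgroup G whole)
  whole-towerSolvable solvable d d-nonZero a =
    let g , g-eq = solvable d d-nonZero (proj₁ ∘ a) in
    (λ n → g n , tt) , λ n → trans (subgroup-· G whole (d n) (g (suc n) , tt)) (g-eq n)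

  torsion : ℕ → Subgroup G ℓ
  torsion n = record
    { member    = λ x → n · x ≈ ε
    ; resp      = λ x≈y nx≈ε → trans (×-congʳ n (sym x≈y)) nx≈ε
    ; ε-closed  = ·-ε n
    ; ∙-closed  = λ {x} {y} nx≈ε ny≈ε →
        trans (×-distrib-+ x y n) (trans (∙-cong nx≈ε ny≈ε) (identityˡ ε))
    ; ⁻¹-closed = λ {x} nx≈ε → trans (·-⁻¹ n x) (trans (⁻¹-cong nx≈ε) ε⁻¹≈ε)
    }

  InfinitelyDivisible : Carrier → Set (c ⊔ ℓ)
  InfinitelyDivisible x = ∀ n .{{_ : NonZero n}} → ∃[ y ] n · y ≈ x

  divisiblePart : Subgroup G (c ⊔ ℓ)
  divisiblePart = record
    { member    = InfinitelyDivisible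
    ; resp      = λ x≈y x/ n → let z , nz≈x = x/ n in z , trans nz≈x x≈y
    ; ε-closed  = λ n → ε , ·-ε n
    ; ∙-closed  = λ x/ y/ n → let u , nu≈x = x/ n ; v , nv≈y = y/ n in
        u ∙ v , trans (×-distrib-+ u v n) (∙-cong nu≈x nv≈y)
    ; ⁻¹-closed = λ x/ n → let u , nu≈x = x/ n in u ⁻¹ , trans (·-⁻¹ n u) (⁻¹-cong nu≈x)
    }

  -- The n-th part y of x must again be infinitely divisible. An (mn)-th part z of x satisfies n (m
  -- z) = n y, and n cancels.
  divisiblePart-divisible : TorsionFree G → Divisible (subgroup G divisiblePart)
  divisiblePart-divisible torsionFree n (x , x/) = let y , ny≈x = x/ n in
    (y , λ m → let z , mnz≈x = x/ (m ℕ.* n) {{ℕ.m*n≢0 m n}} in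
      z , RankOne.·-cancelˡ G torsionFree n
            (trans (·-comm n m z) (trans (×-assocˡ z m n) (trans mnz≈x (sym ny≈x))))) ,
    trans (subgroup-· G divisiblePart n _) ny≈x

module _ (em : ∀ ℓ → ExcludedMiddle ℓ) (fe : ∀ a b → Extensionality a b)
         (G : AbelianGroup 0ℓ 0ℓ) (G-cotorsionFree : CotorsionFree G) where
  open Classical em
  open AbelianGroup G
  open IntegerMultiples G

  cotorsion⇒trivial : ∀ H → Cotorsion (subgroup G H) → Trivial H
  cotorsion⇒trivial H H-cotorsion = by-contradiction λ H-nontrivial →
    G-cotorsionFree (H , (λ triv → H-nontrivial triv) , H-cotorsion)

  -- The elements killed by p form a group of exponent p, which is cotorsion.
  prime-torsion-trivial : ∀ p → Prime p → ∀ {x} → p · x ≈ ε → x ≈ ε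
  prime-torsion-trivial p p-prime {x} = cotorsion⇒trivial (torsion G p)
    (elementary⇒cotorsion em fe {subgroup G (torsion G p)} p p-prime λ h →
      trans (subgroup-· G (torsion G p) p h) (proj₂ h)) {x}

  cotorsionFree⇒torsionFree : TorsionFree G
  cotorsionFree⇒torsionFree n x nx≈ε =
    go (factors) factorsPrime (≡.subst (λ m → m · x ≈ ε) isFactorisation nx≈ε)
    where
    open PrimeFactorisation (factorise n)
    go : ∀ ps → All Prime ps → product ps · x ≈ ε → x ≈ ε
    go []       []                   1x≈ε = trans (sym (×-homo-1 x)) 1x≈ε
    go (p ∷ ps) (p-prime ∷ ps-prime) nx≈ε =
      go ps ps-prime (prime-torsion-trivial p p-prime (trans (×-assocˡ x p (product ps)) nx≈ε))

  cotorsionFree⇒reduced : ∀ {x} → InfinitelyDivisible G x → x ≈ ε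
  cotorsionFree⇒reduced {x} = cotorsion⇒trivial (divisiblePart G)
    (towerSolvable⇒cotorsion em fe {subgroup G (divisiblePart G)}
      (divisible⇒towerSolvable (subgroup G (divisiblePart G))
        (divisiblePart-divisible G cotorsionFree⇒torsionFree))) {x}

  ¬towerSolvable : ¬ (∀ x → x ≈ ε) → ¬ TowerSolvable G
  ¬towerSolvable G-nontrivial solvable = G-nontrivial λ x →
    cotorsion⇒trivial (whole G)
      (towerSolvable⇒cotorsion em fe {subgroup G (whole G)} (whole-towerSolvable G solvable)) {x} tt

module _ (em : ∀ ℓ → ExcludedMiddle ℓ) (fe : ∀ a b → Extensionality a b)
         (G : AbelianGroup 0ℓ 0ℓ) (A : Subgroup G 0ℓ)
         (cotorsionFree : CotorsionFree (quotient G A)) where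
  open Classical em
  open AbelianGroup G
  open IntegerMultiples G
  private
    module Q  = AbelianGroup (quotient G A)
    module MQ = IntegerMultiples (quotient G A)

  -- A is closed in the topology of the subgroups n G. Modulo A, v is nonzero in a reduced group, so
  -- some n+1 does not divide it; an element of A of the form v + (n+1) g would make it divisible.
  cotorsionFree-quotient⇒closed : ∀ v → ¬ v ∈ Subgroup.member A →
    ∃[ n ] ∀ w g → w ≈ suc n · g → ¬ (v ∙ w) ∈ Subgroup.member A
  cotorsionFree-quotient⇒closed v v∉A =
    let n , v∤ = ¬∀⇒∃¬ {P = λ n → ∃[ y ] (suc n MQ.· y) Q.≈ v} not-divisible in
    n , λ w g w≈ng vw∈A → v∤ (g ⁻¹ , ∙·∈⇒quotient-· G A (suc n) {v} {w} {g} w≈ng vw∈A)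
    where
    not-divisible : ¬ (∀ n → ∃[ y ] (suc n MQ.· y) Q.≈ v)
    not-divisible v/ = v∉A (∼ε⇒∈ G A (cotorsionFree⇒reduced em fe (quotient G A) cotorsionFree {v}
      λ { (suc n) → v/ n }))

-- The Baer–Specker group

module ℤω = AbelianGroup ℤ^ω
open IntegerMultiples ℤ^ω using () renaming (_·_ to _·ω_; _⋆_ to _⋆ω_)

·ω-lookup : ∀ n f i → (n ·ω f) i ≡ + n ℤ.* f i
·ω-lookup zero    f i = ≡.sym (ℤ.*-zeroˡ (f i))
·ω-lookup (suc n) f i =
  ≡.trans (≡.cong (λ k → f i ℤ.+ k) (·ω-lookup n f i)) (≡.sym (ℤ.suc-* (+ n) (f i)))

⋆ω-lookup : ∀ k f i → (k ⋆ω f) i ≡ k ℤ.* f i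
⋆ω-lookup (+ n)      f i = ·ω-lookup n f i
⋆ω-lookup (-[1+ n ]) f i =
  ≡.trans (≡.cong ℤ.-_ (·ω-lookup (suc n) f i)) (ℤ.neg-distribˡ-* (+ suc n) (f i))

basis : ℕ → ℤω.Carrier
basis n i = if does (i ℕ.≟ n) then 1ℤ else 0ℤ

basis-diagonal : ∀ n → basis n n ≡ 1ℤ
basis-diagonal n = ≡.cong (if_then 1ℤ else 0ℤ) (dec-true (n ℕ.≟ n) ≡.refl)

basis-off-diagonal : ∀ {n i} → i ≢ n → basis n i ≡ 0ℤ
basis-off-diagonal {n} {i} i≢n = ≡.cong (if_then 1ℤ else 0ℤ) (dec-false (i ℕ.≟ n) i≢n)

module _ (A : Subgroup ℤ^ω 0ℓ) where
  open Subgroups A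
  open AbelianGroupSolver ℤ^ω

  finite-support-closed : ∀ n → (∀ i → i ℕ.< n → basis i ∈ member) →
                          ∀ {f} → (∀ i → n ℕ.≤ i → f i ≡ 0ℤ) → f ∈ member
  finite-support-closed zero    basis∈A f≡0 = resp (λ i → ≡.sym (f≡0 i z≤n)) ε-closed
  finite-support-closed (suc n) basis∈A {f} f≡0 = resp
    (solve 2 (λ f l → ((f ⊝ l) ⊕ l) ⊜ f) ℤω.refl f leading)
    (∙-closed
      (finite-support-closed n (λ i i<n → basis∈A i (ℕ.m<n⇒m<1+n i<n)) remainder≡0)
      (⋆-closed (f n) (basis∈A n ℕ.≤-refl)))
    where
    leading : ℤω.Carrier
    leading = f n ⋆ω basis n

    remainder≡0 : ∀ i → n ℕ.≤ i → f i ℤ.- leading i ≡ 0ℤ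
    remainder≡0 i n≤i with i ℕ.≟ n
    ... | yes ≡.refl = ≡.trans (≡.cong (λ k → f i ℤ.- k)
            (≡.trans (⋆ω-lookup (f i) (basis i) i)
              (≡.trans (≡.cong (f i ℤ.*_) (basis-diagonal i)) (ℤ.*-identityʳ (f i)))))
            (ℤ.+-inverseʳ (f i))
    ... | no i≢n = ≡.cong₂ ℤ._-_ (f≡0 i (ℕ.≤∧≢⇒< n≤i (i≢n ∘ ≡.sym)))
            (≡.trans (⋆ω-lookup (f n) (basis n) i)
              (≡.trans (≡.cong (f n ℤ.*_) (basis-off-diagonal i≢n)) (ℤ.*-zeroʳ (f n))))

  -- Modulo the finitely supported sequences the tower may be solved coordinatewise: coordinate i
  -- only has to satisfy the equations with index at most i, a finite backward recursion.
  quotient-towerSolvable : (∀ n → basis n ∈ member) → TowerSolvable (quotient ℤ^ω A)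
  quotient-towerSolvable basis∈A d d-nonZero a = g , λ n →
    ∈⇒quotient-· ℤ^ω A (d n) {g (suc n)} {g n ℤω.∙ a n}
      (finite-support-closed n (λ i _ → basis∈A i) (difference≡0 n))
    where
    backward : (i fuel n : ℕ) → ℤ
    backward i zero       n = 0ℤ
    backward i (suc fuel) n = + d n ℤ.* backward i fuel (suc n) ℤ.- a n i

    g : ℕ → ℤω.Carrier
    -- With this fuel entry i is 0 for every index n > i, and exactly the equations n ≤ i are
    -- unfolded.
    g n i = backward i (suc i ℕ.∸ n) n

    g-step : ∀ n i → n ℕ.≤ i → g n i ≡ + d n ℤ.* g (suc n) i ℤ.- a n i
    g-step n i n≤i rewrite ℕ.+-∸-assoc 1 n≤i = ≡.refl

    difference≡0 : ∀ n i → n ℕ.≤ i → (d n ·ω g (suc n)) i ℤ.- (g n i ℤ.+ a n i) ≡ 0ℤ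
    difference≡0 n i n≤i = ℤ.i≡j⇒i-j≡0 (begin
      (d n ·ω g (suc n)) i        ≡⟨ ·ω-lookup (d n) (g (suc n)) i ⟩
      dg                          ≡⟨ solveℤ 2 (λ u v → u S.⊜ ((u S.⊝ v) S.⊕ v)) ≡.refl dg (a n i) ⟩
      (dg ℤ.- a n i) ℤ.+ a n i    ≡⟨ ≡.cong (ℤ._+ a n i) (g-step n i n≤i) ⟨
      g n i ℤ.+ a n i             ∎)
      where
      open ≡.≡-Reasoning
      module S = AbelianGroupSolver ℤ.+-0-abelianGroup
      open S using () renaming (solve to solveℤ)
      dg = + d n ℤ.* g (suc n) i

-- The sets FactorialTail m form a base of neighbourhoods of zero in the complete group of
-- all sequences with i! dividing the i-th entry.

FactorialTail : ℕ → Pred ℤω.Carrier 0ℓ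
FactorialTail m f = ∀ i → (i ℕ.< m → f i ≡ 0ℤ) × (∃[ k ] f i ≡ + (i !) ℤ.* k)

factorialTail-antitone : ∀ {m n} → m ℕ.≤ n → FactorialTail n ⊆ FactorialTail m
factorialTail-antitone m≤n f∈ i = (λ i<m → proj₁ (f∈ i) (ℕ.<-≤-trans i<m m≤n)) , proj₂ (f∈ i)

-- Entries before n vanish, and from n on n divides i!. Hence a subgroup closed for the multiples of
-- n is closed for the factorial tails as well.
factorialTail-divisible : ∀ n .{{_ : NonZero n}} {f} → FactorialTail n f → ∃[ g ] f ℤω.≈ n ·ω g
factorialTail-divisible n {f} f∈ =
  (λ i → proj₁ (quotients i)) , λ i → ≡.trans (proj₂ (quotients i)) (≡.sym (·ω-lookup n _ i))
  where
  n∣i! : ∀ {n i} .{{_ : NonZero n}} → n ℕ.≤ i → n ∣ i !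
  n∣i! {suc n} 1+n≤i = ∣-trans (m∣m*n (n !)) (m≤n⇒m!∣n! 1+n≤i)

  quotients : ∀ i → ∃[ q ] f i ≡ + n ℤ.* q
  quotients i with i ℕ.<? n
  ... | yes i<n = 0ℤ , ≡.trans (proj₁ (f∈ i) i<n) (≡.sym (ℤ.*-zeroʳ (+ n)))
  ... | no i≮n with n∣i! {n} {i} (ℕ.≮⇒≥ i≮n) | proj₂ (f∈ i)
  ...   | divides q i!≡qn | k , fi≡i!k = + q ℤ.* k , (begin
    f i                      ≡⟨ fi≡i!k ⟩
    + (i !) ℤ.* k            ≡⟨ ≡.cong (λ m → + m ℤ.* k) (≡.trans i!≡qn (ℕ.*-comm q n)) ⟩
    + (n ℕ.* q) ℤ.* k        ≡⟨ ≡.cong (ℤ._* k) (ℤ.pos-* n q) ⟩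
    (+ n ℤ.* + q) ℤ.* k      ≡⟨ ℤ.*-assoc (+ n) (+ q) k ⟩
    + n ℤ.* (+ q ℤ.* k)      ∎)
    where open ≡.≡-Reasoning

-- Baire's theorem for the sequences divisible by factorials

module _ (em : ∀ ℓ → ExcludedMiddle ℓ) where
  open Classical em
  open AbelianGroupSolver ℤ^ω

  -- Nested balls, the k-th step avoiding `P k`. Since `P k` is a subgroup, having no interior
  -- amounts to containing no neighbourhood of zero.
  baire : (P : ℕ → Subgroup ℤ^ω 0ℓ) →
          (∀ k m → ∃[ u ] FactorialTail m u × ¬ u ∈ Subgroup.member (P k)) →
          (∀ k v → ¬ v ∈ Subgroup.member (P k) →
            ∃[ n ] (∀ w → FactorialTail n w → ¬ (v ℤω.∙ w) ∈ Subgroup.member (P k))) →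
          ∃[ v ] ∀ k → ¬ v ∈ Subgroup.member (P k)
  baire P nowhereDense closed = limit , limit∉P
    where
    -- `radius` counts the entries that are fixed, so a larger radius means a smaller ball.
    record Ball : Set where
      field
        centre  : ℤω.Carrier
        centre∈ : FactorialTail 0 centre
        radius  : ℕ

    open Ball

    record Shrink (k : ℕ) (B : Ball) : Set where
      field
        ball    : Ball
        agree   : ∀ i → i ℕ.< radius B → centre ball i ≡ centre B i
        radius> : radius B ℕ.< radius ball
        avoids  : ∀ w → FactorialTail (radius ball) w →
                  ¬ (centre ball ℤω.∙ w) ∈ Subgroup.member (P k)

    factorial-+ : ∀ {u v} → FactorialTail 0 u → FactorialTail 0 v → FactorialTail 0 (u ℤω.∙ v)
    factorial-+ u∈ v∈ i = (λ ()) , let k , ui≡ = proj₂ (u∈ i) ; l , vi≡ = proj₂ (v∈ i) in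
      k ℤ.+ l , ≡.trans (≡.cong₂ ℤ._+_ ui≡ vi≡) (≡.sym (ℤ.*-distribˡ-+ (+ (i !)) k l))

    shrink-around : ∀ {k B} v → FactorialTail 0 v → (∀ i → i ℕ.< radius B → v i ≡ centre B i) →
                    ¬ v ∈ Subgroup.member (P k) → Shrink k B
    shrink-around {k} {B} v v∈ agree v∉P = let n , avoids = closed k v v∉P in record
      -- Beyond the n needed to avoid `P k`, the radius must grow at every step so that each entry
      -- is eventually fixed.
      { ball    = record { centre = v ; centre∈ = v∈ ; radius = suc (radius B) ℕ.⊔ n }
      ; agree   = agree
      ; radius> = ℕ.m≤m⊔n (suc (radius B)) n
      ; avoids  = λ w w∈ → avoids w (factorialTail-antitone (ℕ.m≤n⊔m (suc (radius B)) n) w∈)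
      }

    shrink : ∀ k B → Shrink k B
    shrink k B with em 0ℓ {centre B ∈ Subgroup.member (P k)}
    ... | no v∉P  = shrink-around (centre B) (centre∈ B) (λ _ _ → ≡.refl) v∉P
    ... | yes v∈P = let u , u∈ , u∉P = nowhereDense k (radius B) in
      shrink-around (v ℤω.∙ u) (factorial-+ {v} {u} (centre∈ B) (factorialTail-antitone z≤n u∈))
        (λ i i<m → ≡.trans (≡.cong (λ z → v i ℤ.+ z) (proj₁ (u∈ i) i<m)) (ℤ.+-identityʳ (v i)))
        (λ vu∈P → u∉P (Subgroup.resp (P k)
          (solve 2 (λ u v → ((v ⊕ u) ⊝ v) ⊜ u) ℤω.refl u v)
          (Subgroups.-‿closed (P k) vu∈P v∈P)))
      where
      v : ℤω.Carrier
      v = centre B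

    balls : ℕ → Ball
    shrunk : ∀ k → Shrink k (balls k)
    balls zero = record
      { centre = λ _ → 0ℤ ; centre∈ = λ i → (λ ()) , 0ℤ , ≡.sym (ℤ.*-zeroʳ (+ (i !))) ; radius = 0 }
    balls (suc k) = Shrink.ball (shrunk k)
    shrunk k = shrink k (balls k)

    v : ℕ → ℤω.Carrier
    v k = centre (balls k)

    m : ℕ → ℕ
    m k = radius (balls k)

    k≤m : ∀ k → k ℕ.≤ m k
    k≤m zero    = z≤n
    k≤m (suc k) = ℕ.≤-<-trans (k≤m k) (Shrink.radius> (shrunk k))

    m-mono : ∀ {j k} → j ℕ.≤′ k → m j ℕ.≤ m k
    m-mono ℕ.≤′-refl       = ℕ.≤-refl
    m-mono (ℕ.≤′-step j≤k) = ℕ.≤-trans (m-mono j≤k) (ℕ.<⇒≤ (Shrink.radius> (shrunk _)))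

    stable : ∀ {j k} → j ℕ.≤′ k → ∀ i → i ℕ.< m j → v k i ≡ v j i
    stable ℕ.≤′-refl       i i<m = ≡.refl
    stable (ℕ.≤′-step j≤k) i i<m =
      ≡.trans (Shrink.agree (shrunk _) i (ℕ.<-≤-trans i<m (m-mono j≤k))) (stable j≤k i i<m)

    limit : ℤω.Carrier
    -- Stage i+1 has radius at least i+1, so it is certain to have fixed entry i.
    limit i = v (suc i) i

    limit-agrees : ∀ k i → i ℕ.< m k → limit i ≡ v k i
    limit-agrees k i i<m with ℕ.≤-total k (suc i)
    ... | inj₁ k≤1+i = stable (ℕ.≤⇒≤′ k≤1+i) i i<m
    ... | inj₂ 1+i≤k = ≡.sym (stable (ℕ.≤⇒≤′ 1+i≤k) i (k≤m (suc i)))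

    limit-near : ∀ k → FactorialTail (m k) (limit ℤω.- v k)
    limit-near k i = (λ i<m → ℤ.i≡j⇒i-j≡0 (limit-agrees k i i<m)) , a ℤ.- b , (begin
      limit i ℤ.- v k i              ≡⟨ ≡.cong₂ ℤ._-_ limit≡i!a v≡i!b ⟩
      i! ℤ.* a ℤ.- i! ℤ.* b          ≡⟨ ≡.cong (λ z → i! ℤ.* a ℤ.+ z) (ℤ.neg-distribʳ-* i! b) ⟩
      i! ℤ.* a ℤ.+ i! ℤ.* (ℤ.- b)    ≡⟨ ℤ.*-distribˡ-+ i! a (ℤ.- b) ⟨
      i! ℤ.* (a ℤ.- b)               ∎)
      where
      open ≡.≡-Reasoning
      i! = + (i !)
      a = proj₁ (proj₂ (centre∈ (balls (suc i)) i))
      limit≡i!a = proj₂ (proj₂ (centre∈ (balls (suc i)) i))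
      b = proj₁ (proj₂ (centre∈ (balls k) i))
      v≡i!b = proj₂ (proj₂ (centre∈ (balls k) i))

    limit∉P : ∀ k → ¬ limit ∈ Subgroup.member (P k)
    limit∉P k limit∈P = Shrink.avoids (shrunk k) (limit ℤω.- v (suc k)) (limit-near (suc k))
      (Subgroup.resp (P k)
        (solve 2 (λ l v → l ⊜ (v ⊕ (l ⊝ v))) ℤω.refl limit (v (suc k)))
        limit∈P)

-- Subgroups of the Baer-Specker group with cotorsionfree quotient

module _ (em : ∀ ℓ → ExcludedMiddle ℓ) (fe : ∀ a b → Extensionality a b)
         (A : Subgroup ℤ^ω 0ℓ) (cotorsionFree : CotorsionFree (quotient ℤ^ω A)) where
  open Subgroups A
  private
    Q = quotient ℤ^ω A

  -- With all unit vectors in A the quotient solves every tower system and is cotorsion. Being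
  -- cotorsionfree too, it would vanish.
  proper⇒basis⊈ : Proper A → ¬ (∀ n → basis n ∈ member)
  proper⇒basis⊈ proper basis∈A = ¬towerSolvable em fe Q cotorsionFree
    (λ all∼ε → proper λ f → ∼ε⇒∈ ℤ^ω A {f} (all∼ε f)) (quotient-towerSolvable A basis∈A)

  closed : ∀ v → ¬ v ∈ member → ∃[ n ] (∀ w → FactorialTail n w → ¬ (v ℤω.∙ w) ∈ member)
  closed v v∉A =
    let n , v∤ = cotorsionFree-quotient⇒closed em fe ℤ^ω A cotorsionFree v v∉A in
    suc n , λ w w∈ → let g , w≈ng = factorialTail-divisible (suc n) w∈ in v∤ w g w≈ng

  -- The multiple n! of the unit vector lies in the tail, and n! cancels in the torsionfree
  -- quotient.
  factorialTail⊆⇒basis∈ : ∀ {m} → FactorialTail m ⊆ member → ∀ n → m ℕ.≤ n → basis n ∈ member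
  factorialTail⊆⇒basis∈ {m} tail⊆A n m≤n = quotient-torsionFree⁻ ℤ^ω A
    (cotorsionFree⇒torsionFree em fe Q cotorsionFree) (n !) {{n ℕ.!≢0}} {basis n}
    (tail⊆A {(n !) ·ω basis n} λ i →
      (λ i<m → off-diagonal (ℕ.<⇒≢ (ℕ.<-≤-trans i<m m≤n))) , multiple i)
    where
    off-diagonal : ∀ {i} → i ≢ n → ((n !) ·ω basis n) i ≡ 0ℤ
    off-diagonal {i} i≢n = begin
      ((n !) ·ω basis n) i    ≡⟨ ·ω-lookup (n !) (basis n) i ⟩
      + (n !) ℤ.* basis n i   ≡⟨ ≡.cong (+ (n !) ℤ.*_) (basis-off-diagonal i≢n) ⟩
      + (n !) ℤ.* 0ℤ          ≡⟨ ℤ.*-zeroʳ (+ (n !)) ⟩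
      0ℤ                      ∎
      where open ≡.≡-Reasoning

    multiple : ∀ i → ∃[ k ] ((n !) ·ω basis n) i ≡ + (i !) ℤ.* k
    multiple i with i ℕ.≟ n
    ... | yes ≡.refl = basis n n , ·ω-lookup (n !) (basis n) n
    ... | no i≢n     = 0ℤ , ≡.trans (off-diagonal i≢n) (≡.sym (ℤ.*-zeroʳ (+ (i !))))

theorem1p4 : (∀ ℓ → ExcludedMiddle ℓ) →
    (∀ a b → Extensionality a b) →
    ∀ {ℓ₁ ℓ₂ ℓ₃} (δ : Ordinal ℓ₁ ℓ₂ ℓ₃)
    (A : Ordinal.Carrier δ → Subgroup ℤ^ω 0ℓ) →
    Ascending δ A →
    (∀ α → Proper (A α)) →
    (∀ α → CotorsionFree (quotient ℤ^ω (A α))) →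
    ¬ (U {A = AbelianGroup.Carrier ℤ^ω} ≐ ⋃ (Ordinal.Carrier δ) (λ α → Subgroup.member (A α)))
theorem1p4 em fe δ A ascending proper cotorsionFree (covered , _) =
  let v , v∉P = baire em P nowhereDense (λ k → closed em fe (P k) (cotorsionFree (index k)))
      k , v∈P = countably-covered v
  in v∉P k v∈P
  where
  open Classical em

  -- These indices need not increase with n.
  index : ℕ → Ordinal.Carrier δ
  index n = proj₁ (covered {basis n} _)

  P : ℕ → Subgroup ℤ^ω 0ℓ
  P n = A (index n)

  total : ∀ α β → A α ≤ₛ A β ⊎ A β ≤ₛ A α
  total α β with StrictTotalOrder.compare (Ordinal.strictTotalOrder δ) α β
  ... | tri< α<β _ _ = inj₁ (ascending (inj₁ α<β))
  ... | tri≈ _ α≈β _ = inj₁ (ascending (inj₂ α≈β))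
  ... | tri> _ _ β<α = inj₂ (ascending (inj₁ β<α))

  missing-basis : ∀ α → ¬ (∀ n → basis n ∈ Subgroup.member (A α))
  missing-basis α = proper⇒basis⊈ em fe (A α) (cotorsionFree α) (proper α)

  basis∈P : ∀ n → basis n ∈ Subgroup.member (P n)
  basis∈P n = proj₂ (covered {basis n} _)

  -- The member containing x misses some `basis n`, which `P n` contains. So `P n` is not below that
  -- member and, the chain being linear, lies above it.
  countably-covered : ∀ x → ∃[ k ] x ∈ Subgroup.member (P k)
  countably-covered x =
    let α , x∈A = covered {x} _
        n , basis∉A = ¬∀⇒∃¬ (missing-basis α)
    in n , [ (λ A≤P → A≤P x∈A) , (λ P≤A → contradiction (P≤A (basis∈P n)) basis∉A) ]′
         (total α (index n))

  -- Each step keeps the larger of the current member and `P m`: only finitely many members are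
  -- compared, so a greatest one exists.
  collect : ∀ α m → ∃[ β ] A α ≤ₛ A β × (∀ i → i ℕ.< m → basis i ∈ Subgroup.member (A β))
  collect α zero    = α , (λ x∈ → x∈) , λ _ ()
  collect α (suc m) with collect α m
  ... | β , α≤β , basis∈β with total β (index m)
  ...   | inj₁ β≤P = index m , (λ x∈ → β≤P (α≤β x∈)) , λ i i<1+m →
    [ (λ i<m → β≤P (basis∈β i i<m)) , (λ { ≡.refl → basis∈P m }) ]′
      (ℕ.m≤n⇒m<n∨m≡n (ℕ.s≤s⁻¹ i<1+m))
  ...   | inj₂ P≤β = β , α≤β , λ i i<1+m →
    [ basis∈β i , (λ { ≡.refl → P≤β (basis∈P m) }) ]′ (ℕ.m≤n⇒m<n∨m≡n (ℕ.s≤s⁻¹ i<1+m))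

  -- A tail inside `P k` supplies the unit vectors from m on, and `collect` finds a member above
  -- `P k` with the earlier ones; no member contains all of them.
  tail⊈ : ∀ k m → ¬ FactorialTail m ⊆ Subgroup.member (P k)
  tail⊈ k m tail⊆P = let β , P≤β , basis∈β = collect (index k) m in
    missing-basis β λ n → [ basis∈β n , (λ m≤n → P≤β {basis n} (tail-basis∈P n m≤n)) ]′
      (ℕ.<-≤-connex n m)
    where
    tail-basis∈P : ∀ n → m ℕ.≤ n → basis n ∈ Subgroup.member (P k)
    tail-basis∈P = factorialTail⊆⇒basis∈ em fe (P k) (cotorsionFree (index k)) tail⊆P

  nowhereDense : ∀ k m → ∃[ u ] FactorialTail m u × ¬ u ∈ Subgroup.member (P k)
  nowhereDense k m = by-contradiction λ ∄u →
    tail⊈ k m λ {u} u∈ → by-contradiction λ u∉P → ∄u (u , u∈ , u∉P)
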